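{- There exists a computable enumeration of all effective quasi-Polish $\omega$-continuous domains; namely, there is a computable sequence $(\prec_i)_{i\in\omega}$ (given by c.e. indices) of c.e. interpolable transitive relations on $\omega$ such that for every c.e. interpolable transitive relation $\prec$ on $\omega$ there is $i\in\omega$ with $\mathcal{I}(\prec_i)$ computably homeomorphic to $\mathcal{I}(\prec)$.
   Context: A transitive relation $\prec$ on $\omega$ is interpolable if each initial segment $\{x\mid x\prec y\}$ is directed (non-empty and any two elements have an upper bound in it). For a transitive relation $\prec$, an ideal is a non-empty set $I\subseteq\omega$ which is a lower set and directed; $\mathcal{I}(\prec)$ is the space of ideals with topology generated by $[n]_\prec=\{I\mid n\in I\}$, numbered by $n$. For interpolable c.e. $\prec$, $\mathcal{I}(\prec)$ is an $\omega$-continuous domain and an effective quasi-Polish space. A computable homeomorphism is a homeomorphism such that preimages of basic open sets under it and its inverse are uniformly c.e. unions of basic open sets. -}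

module Defs where

open import Data.List.Relation.Unary.All using (All)
open import Data.Nat.Base using (ℕ; zero; suc; _+_; _<_)
open import Data.Nat.Properties using (+-identityʳ; +-suc)
open import Data.Product.Base using (_×_; _,_; ∃-syntax; proj₁; proj₂)
open import Data.Product.Properties using (,-injective)
open import Function.Base using (_∘_)
open import Function.Bundles using (_⇔_; Inverse)
open import Level using (0ℓ) renaming (suc to lsuc)
open import Relation.Binary.Bundles using (Setoid)
open import Relation.Binary.Core using (Rel)
open import Relation.Binary.Definitions using (Transitive)
import Relation.Binary.Construct.On as On
open import Relation.Binary.PropositionalEquality
  using (_≡_; refl; sym; trans; cong)
open import Relation.Unary using (Pred; _∈_; _⊢_)
open import Relation.Unary.Relation.Binary.Equality using (≐-setoid)

triangle : ℕ → ℕ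
triangle zero      = zero
triangle (suc n)   = suc n + triangle n

-- The Cantor pairing, opaque so that Gödel numbers are not evaluated during type checking.

opaque
  ⟨_,_⟩ : ℕ → ℕ → ℕ
  ⟨ x , y ⟩ = y + triangle (x + y)

-- The inverse of ⟨_,_⟩ walks along the antidiagonals.

next : ℕ × ℕ → ℕ × ℕ
next (zero  , y) = suc y , zero
next (suc x , y) = x , suc y

unpair : ℕ → ℕ × ℕ
unpair zero    = zero , zero
unpair (suc n) = next (unpair n)

π₁ π₂ : ℕ → ℕ
π₁ = proj₁ ∘ unpair
π₂ = proj₂ ∘ unpair

unpair-triangle : ∀ s → unpair (triangle s) ≡ (s , 0)
unpair-antidiagonal : ∀ s x y → x + y ≡ s → unpair (y + triangle s) ≡ (x , y)

unpair-triangle zero    = refl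
unpair-triangle (suc s) = cong next (unpair-antidiagonal s 0 s refl)

unpair-antidiagonal s x zero    eq =
  trans (unpair-triangle s) (cong (_, 0) (trans (sym eq) (+-identityʳ x)))
unpair-antidiagonal s x (suc y) eq =
  cong next (unpair-antidiagonal s (suc x) y (trans (sym (+-suc x y)) eq))

opaque
  unfolding ⟨_,_⟩

  unpair-pair : ∀ x y → unpair ⟨ x , y ⟩ ≡ (x , y)
  unpair-pair x y = unpair-antidiagonal (x + y) x y refl

⟨,⟩-injective : ∀ {x y x′ y′} → ⟨ x , y ⟩ ≡ ⟨ x′ , y′ ⟩ → x ≡ x′ × y ≡ y′
⟨,⟩-injective {x} {y} {x′} {y′} eq = ,-injective
  (trans (sym (unpair-pair x y)) (trans (cong unpair eq) (unpair-pair x′ y′)))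

-- Programs for unary partial recursive functions; several arguments are
-- passed as one through ⟨_,_⟩.

data Code : Set where
  zeroᶜ succᶜ leftᶜ rightᶜ : Code
  pairᶜ compᶜ precᶜ : Code → Code → Code
  μᶜ : Code → Code

-- A partial function is given by its graph; ⟦ c ⟧ x v says that program c
-- on input x halts with output v.

_⇀_ : Set → Set → Set₁
A ⇀ B = A → B → Set

-- h a 0 ≃ f a,  h a (n + 1) ≃ g ⟨ a , ⟨ n , h a n ⟩ ⟩

rec : ℕ ⇀ ℕ → ℕ ⇀ ℕ → ℕ → ℕ ⇀ ℕ
rec f g a zero    v = f a v
rec f g a (suc n) v = ∃[ u ] rec f g a n u × g ⟨ a , ⟨ n , u ⟩ ⟩ v

⟦_⟧ : Code → ℕ ⇀ ℕ
⟦ zeroᶜ     ⟧ x v = v ≡ 0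
⟦ succᶜ     ⟧ x v = v ≡ suc x
⟦ leftᶜ     ⟧ x v = v ≡ π₁ x
⟦ rightᶜ    ⟧ x v = v ≡ π₂ x
⟦ pairᶜ f g ⟧ x v = ∃[ u ] ∃[ w ] ⟦ f ⟧ x u × ⟦ g ⟧ x w × v ≡ ⟨ u , w ⟩
⟦ compᶜ f g ⟧ x v = ∃[ u ] ⟦ g ⟧ x u × ⟦ f ⟧ u v
⟦ precᶜ f g ⟧ x v = rec ⟦ f ⟧ ⟦ g ⟧ (π₁ x) (π₂ x) v
⟦ μᶜ f      ⟧ x v =
  ⟦ f ⟧ ⟨ x , v ⟩ 0 × (∀ k → k < v → ∃[ m ] ⟦ f ⟧ ⟨ x , k ⟩ (suc m))

tag : Code → ℕ
tag zeroᶜ       = 0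
tag succᶜ       = 1
tag leftᶜ       = 2
tag rightᶜ      = 3
tag (pairᶜ _ _) = 4
tag (compᶜ _ _) = 5
tag (precᶜ _ _) = 6
tag (μᶜ _)      = 7

encode  : Code → ℕ
payload : Code → ℕ

encode c = ⟨ tag c , payload c ⟩

payload zeroᶜ       = 0
payload succᶜ       = 0
payload leftᶜ       = 0
payload rightᶜ      = 0
payload (pairᶜ f g) = ⟨ encode f , encode g ⟩
payload (compᶜ f g) = ⟨ encode f , encode g ⟩
payload (precᶜ f g) = ⟨ encode f , encode g ⟩
payload (μᶜ f)      = encode f

encode-injective : ∀ c d → encode c ≡ encode d → c ≡ d
payload-injective : ∀ c d → tag c ≡ tag d → payload c ≡ payload d → c ≡ d
operands-injective : ∀ f g f′ g′ →
  ⟨ encode f , encode g ⟩ ≡ ⟨ encode f′ , encode g′ ⟩ → f ≡ f′ × g ≡ g′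

encode-injective c d eq = payload-injective c d
  (proj₁ (⟨,⟩-injective eq)) (proj₂ (⟨,⟩-injective eq))

operands-injective f g f′ g′ eq =
  encode-injective f f′ (proj₁ (⟨,⟩-injective eq)) ,
  encode-injective g g′ (proj₂ (⟨,⟩-injective eq))

payload-injective zeroᶜ  zeroᶜ  _ _ = refl
payload-injective succᶜ  succᶜ  _ _ = refl
payload-injective leftᶜ  leftᶜ  _ _ = refl
payload-injective rightᶜ rightᶜ _ _ = refl
payload-injective (pairᶜ f g) (pairᶜ f′ g′) refl eq with operands-injective f g f′ g′ eq
... | refl , refl = refl
payload-injective (compᶜ f g) (compᶜ f′ g′) refl eq with operands-injective f g f′ g′ eq
... | refl , refl = refl
payload-injective (precᶜ f g) (precᶜ f′ g′) refl eq with operands-injective f g f′ g′ eq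
... | refl , refl = refl
payload-injective (μᶜ f) (μᶜ f′) refl eq = cong μᶜ (encode-injective f f′ eq)

Computable : (ℕ → ℕ) → Set
Computable f = ∃[ c ] ∀ x → ⟦ c ⟧ x (f x)

Dom : Code → Pred ℕ 0ℓ
Dom c x = ∃[ v ] ⟦ c ⟧ x v

-- The c.e. set with index e. Since encode is injective, at most one program
-- contributes; a number that encodes no program is an index of ∅.

W : ℕ → Pred ℕ 0ℓ
W e x = ∃[ c ] encode c ≡ e × x ∈ Dom c

W₂ : ℕ → Rel ℕ 0ℓ
W₂ e x y = ⟨ x , y ⟩ ∈ W e

CE : Rel ℕ 0ℓ → Set
CE _≺_ = ∃[ c ] ∀ x y → x ≺ y ⇔ ⟨ x , y ⟩ ∈ Dom c

Directed : Rel ℕ 0ℓ → Pred ℕ 0ℓ → Set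
Directed _≺_ A =
  (∃[ x ] x ∈ A) × (∀ {x y} → x ∈ A → y ∈ A → ∃[ z ] z ∈ A × x ≺ z × y ≺ z)

Interpolable : Rel ℕ 0ℓ → Set
Interpolable _≺_ = Transitive _≺_ × (∀ y → Directed _≺_ (_≺ y))

record Ideal (_≺_ : Rel ℕ 0ℓ) : Set₁ where
  field
    member   : Pred ℕ 0ℓ
    lower    : ∀ {x y} → x ≺ y → y ∈ member → x ∈ member
    directed : Directed _≺_ member

open Ideal public using (member)

𝓘 : Rel ℕ 0ℓ → Setoid (lsuc 0ℓ) 0ℓ
𝓘 _≺_ = On.setoid (≐-setoid ℕ 0ℓ) (member {_≺_})

[_] : ∀ {_≺_} → ℕ → Pred (Ideal _≺_) 0ℓ
[ n ] I = n ∈ member I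

-- The topology generated by the sets [ n ]: each point of U has a finite
-- intersection of sets [ n ] as a neighbourhood inside U. Predicates in Set₁
-- allow unions of Set₁-indexed families, e.g. families of ideals.

Open : ∀ {_≺_} → Pred (Ideal _≺_) (lsuc 0ℓ) → Set₁
Open {_≺_} U = ∀ I → I ∈ U →
  ∃[ ns ] All (λ n → I ∈ [ n ]) ns × (∀ (J : Ideal _≺_) → All (λ n → J ∈ [ n ]) ns → J ∈ U)

module _ {_≺_ _⊏_ : Rel ℕ 0ℓ} where

  Continuous : (Ideal _≺_ → Ideal _⊏_) → Set₂
  Continuous f = ∀ U → Open U → Open (f ⊢ U)

  -- f⁻¹ [ n ] is the union of the [ m ] with A n m, where A is c.e.

  Effective : (Ideal _≺_ → Ideal _⊏_) → Set₁
  Effective f = ∃[ A ] CE A × (∀ n I → f I ∈ [ n ] ⇔ (∃[ m ] A n m × I ∈ [ m ]))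

record ComputableHomeomorphism (_≺_ _⊏_ : Rel ℕ 0ℓ) : Set₂ where
  field
    bijection : Inverse (𝓘 _≺_) (𝓘 _⊏_)

  open Inverse bijection public using (to; from)

  field
    to-continuous   : Continuous to
    from-continuous : Continuous from
    to-effective    : Effective to
    from-effective  : Effective from

{-# OPTIONS --safe #-}
module Submission where

-- Every c.e. relation ≺ is turned into an interpolable one, ⋖, by adjoining interpolants as
-- formal symbols. Its elements are symbols base n for the numbers n and, below every element t,
-- an increasing sequence child t 0, child t 1, …; as soon as the k-th enumerated edge is x ⋖ t,
-- the edge x ⋖ child t (k + 1) is promised. So ⋖ is interpolable whatever ≺ is. Meanwhile each
-- symbol child t k waits to be resolved to an actual number u: one that is found to lie in the
-- right place with respect to ≺ and the finitely many promises made to child t k. Resolved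
-- elements inherit the edges of ≺. If ≺ is interpolable, every symbol is eventually resolved,
-- ⋖ is the pullback of ≺ along the resolution map, and the two ideal spaces agree.
-- The construction is primitive recursive in a stage-wise enumeration O of ≺, uniformly in a
-- μ-free program for O; these programs are easily enumerated, and by running programs with a
-- time bound they suffice for all c.e. relations.

open import Data.List.Base using ([]; _∷_)
open import Data.List.Relation.Unary.All using (All; []; _∷_)
open import Data.Nat.Base
open import Data.Nat.Induction using (<-rec)
open import Data.Nat.Properties
open import Data.Product.Base using (_×_; _,_; ∃-syntax; proj₁; proj₂)
open import Data.Sum.Base using (_⊎_; inj₁; inj₂)
open import Function.Base using (_∘_; id)
open import Function.Bundles using (_⇔_; mk⇔; Equivalence; Inverse)
open import Level using (0ℓ)
open import Relation.Binary.Core using (Rel)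
open import Relation.Binary.PropositionalEquality.Core
  using (_≡_; _≢_; refl; sym; trans; cong; cong₂; subst; subst₂)
open import Relation.Nullary using (yes; no; contradiction)
open import Relation.Unary using (_∈_)
open import Defs

-- Cantor pairing: the inverse and size estimates

π₁-pair : ∀ x y → π₁ ⟨ x , y ⟩ ≡ x
π₁-pair x y = cong proj₁ (unpair-pair x y)

π₂-pair : ∀ x y → π₂ ⟨ x , y ⟩ ≡ y
π₂-pair x y = cong proj₂ (unpair-pair x y)

triangle-mono-≤ : ∀ {m n} → m ≤ n → triangle m ≤ triangle n
triangle-mono-≤ z≤n     = z≤n
triangle-mono-≤ (s≤s p) = +-mono-≤ (s≤s p) (triangle-mono-≤ p)

n≤triangle : ∀ n → n ≤ triangle n
n≤triangle zero    = z≤n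
n≤triangle (suc n) = m≤m+n (suc n) (triangle n)

opaque
  unfolding ⟨_,_⟩

  -- `next` walks along the antidiagonals in the order of their Cantor numbers; surjectivity of the
  -- pairing follows by induction along this walk.
  pair-next : ∀ p → ⟨ proj₁ (next p) , proj₂ (next p) ⟩ ≡ suc ⟨ proj₁ p , proj₂ p ⟩
  pair-next (zero  , y) = cong (λ s → suc s + triangle s) (+-identityʳ y)
  pair-next (suc x , y) = cong (λ s → suc y + triangle s) (+-suc x y)

  pair-mono-≤ : ∀ {x y x′ y′} → x ≤ x′ → y ≤ y′ → ⟨ x , y ⟩ ≤ ⟨ x′ , y′ ⟩
  pair-mono-≤ p q = +-mono-≤ q (triangle-mono-≤ (+-mono-≤ p q))

  pair-suc : ∀ x y → ⟨ suc x , y ⟩ ≡ suc (x + y) + ⟨ x , y ⟩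
  pair-suc x y = trans (sym (+-assoc y (suc (x + y)) _))
    (trans (cong (_+ triangle (x + y)) (+-comm y (suc (x + y)))) (+-assoc (suc (x + y)) y _))

  -- The triangular number is at least `m + n`, so the second component counts twice. This factor
  -- two later absorbs the bound `suc (k + k)` on the source of edge `k`.
  m+2n≤pair : ∀ m n → n + (m + n) ≤ ⟨ m , n ⟩
  m+2n≤pair m n = +-monoʳ-≤ n (n≤triangle (m + n))

pair-π : ∀ n → ⟨ π₁ n , π₂ n ⟩ ≡ n
pair-π zero    = pair-zero
  where
  opaque
    unfolding ⟨_,_⟩
    pair-zero : ⟨ 0 , 0 ⟩ ≡ 0
    pair-zero = refl
pair-π (suc n) = trans (pair-next (unpair n)) (cong suc (pair-π n))

m+n≤pair : ∀ m n → m + n ≤ ⟨ m , n ⟩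
m+n≤pair m n = ≤-trans (m≤n+m (m + n) n) (m+2n≤pair m n)

m≤pair : ∀ m n → m ≤ ⟨ m , n ⟩
m≤pair m n = ≤-trans (m≤m+n m n) (m+n≤pair m n)

n≤pair : ∀ m n → n ≤ ⟨ m , n ⟩
n≤pair m n = ≤-trans (m≤n+m n m) (m+n≤pair m n)

n<pair : ∀ m n → n < ⟨ suc m , n ⟩
n<pair m n = ≤-trans (s≤s (m≤n+m n m)) (m+n≤pair (suc m) n)

pair-<ˡ : ∀ m n → ⟨ m , n ⟩ < ⟨ suc m , n ⟩
pair-<ˡ m n rewrite pair-suc m n = s≤s (m≤n+m ⟨ m , n ⟩ (m + n))

π₁-≤ : ∀ n → π₁ n ≤ n
π₁-≤ n = subst (π₁ n ≤_) (pair-π n) (m≤pair (π₁ n) (π₂ n))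

π₂-≤ : ∀ n → π₂ n ≤ n
π₂-≤ n = subst (π₂ n ≤_) (pair-π n) (n≤pair (π₁ n) (π₂ n))

-- Primitive recursion relative to an oracle

natrec : ℕ → (ℕ → ℕ → ℕ) → ℕ → ℕ
natrec b s zero    = b
natrec b s (suc n) = s n (natrec b s n)

natrec-cong : ∀ {b b′ s s′} → b ≡ b′ → (∀ k u → s k u ≡ s′ k u) →
  ∀ n → natrec b s n ≡ natrec b′ s′ n
natrec-cong p q zero    = p
natrec-cong {s = s} p q (suc n) =
  trans (cong (s n) (natrec-cong p q n)) (q n _)

data Prim : Set where
  oracleᵖ zeroᵖ succᵖ leftᵖ rightᵖ : Prim
  pairᵖ compᵖ precᵖ : Prim → Prim → Prim

eval : (ℕ → ℕ) → Prim → ℕ → ℕ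
eval O oracleᵖ     x = O x
eval O zeroᵖ       x = 0
eval O succᵖ       x = suc x
eval O leftᵖ       x = π₁ x
eval O rightᵖ      x = π₂ x
eval O (pairᵖ f g) x = ⟨ eval O f x , eval O g x ⟩
eval O (compᵖ f g) x = eval O f (eval O g x)
eval O (precᵖ f g) x =
  natrec (eval O f (π₁ x)) (λ n u → eval O g ⟨ π₁ x , ⟨ n , u ⟩ ⟩) (π₂ x)

-- plug d p is p as a program, with d answering the oracle queries.

plug : Code → Prim → Code
plug d oracleᵖ     = d
plug d zeroᵖ       = zeroᶜ
plug d succᵖ       = succᶜ
plug d leftᵖ       = leftᶜ
plug d rightᵖ      = rightᶜ
plug d (pairᵖ f g) = pairᶜ (plug d f) (plug d g)
plug d (compᵖ f g) = compᶜ (plug d f) (plug d g)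
plug d (precᵖ f g) = precᶜ (plug d f) (plug d g)

-- An equivalence rather than mere halting: a given computation also determines its output, which
-- turns facts about `Dom` into equations for `F`.
record Computes (c : Code) (F : ℕ → ℕ) : Set where
  constructor computes
  field
    graph : ∀ x v → ⟦ c ⟧ x v ⇔ v ≡ F x

  value : ∀ x → ⟦ c ⟧ x (F x)
  value x = Equivalence.from (graph x _) refl

  unique : ∀ {x v} → ⟦ c ⟧ x v → v ≡ F x
  unique = Equivalence.to (graph _ _)
open Computes

rec-natrec : ∀ {f g F G} → Computes f F → Computes g G → ∀ a n v →
  rec ⟦ f ⟧ ⟦ g ⟧ a n v ⇔ v ≡ natrec (F a) (λ k u → G ⟨ a , ⟨ k , u ⟩ ⟩) n
rec-natrec hf hg a zero v = graph hf a v
rec-natrec {f} {g} {F} {G} hf hg a (suc n) v = mk⇔ ⇒ ⇐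
  where
  loop = natrec (F a) (λ k u → G ⟨ a , ⟨ k , u ⟩ ⟩)
  ih : ∀ u → rec ⟦ f ⟧ ⟦ g ⟧ a n u ⇔ u ≡ loop n
  ih = rec-natrec {f} {g} hf hg a n
  ⇒ : rec ⟦ f ⟧ ⟦ g ⟧ a (suc n) v → v ≡ loop (suc n)
  ⇒ (u , p , q) with Equivalence.to (ih u) p
  ... | refl = unique hg q
  ⇐ : v ≡ loop (suc n) → rec ⟦ f ⟧ ⟦ g ⟧ a (suc n) v
  ⇐ refl = loop n , Equivalence.from (ih _) refl , value hg _

plug-computes : ∀ {d O} → Computes d O → ∀ p → Computes (plug d p) (eval O p)
plug-computes h oracleᵖ = h
plug-computes h zeroᵖ  = computes λ x v → mk⇔ id id
plug-computes h succᵖ  = computes λ x v → mk⇔ id id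
plug-computes h leftᵖ  = computes λ x v → mk⇔ id id
plug-computes h rightᵖ = computes λ x v → mk⇔ id id
plug-computes h (pairᵖ f g) = computes λ x v → mk⇔
  (λ (u , w , p , q , r) → trans r (cong₂ ⟨_,_⟩ (unique hf p) (unique hg q)))
  (λ r → _ , _ , value hf x , value hg x , r)
  where
  hf = plug-computes h f
  hg = plug-computes h g
plug-computes {d} {O} h (compᵖ f g) = computes λ x v → mk⇔
  (λ (u , p , q) → trans (unique hf q) (cong (eval O f) (unique hg p)))
  (λ r → _ , value hg x , Equivalence.from (graph hf _ v) r)
  where
  hf = plug-computes h f
  hg = plug-computes h g
plug-computes {d} {O} h (precᵖ f g) = computes λ x v →
  rec-natrec {plug d f} {plug d g} (plug-computes h f) (plug-computes h g) (π₁ x) (π₂ x) v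

zeroᶜ-computes : Computes zeroᶜ (λ _ → 0)
zeroᶜ-computes = computes λ x v → mk⇔ id id

-- An argument x of an operator serves as the context of an expression: the closure properties
-- below are stated pointwise in x, so that the proof of PR F mirrors the expression F O x.

Operator : Set
Operator = (ℕ → ℕ) → ℕ → ℕ

record PR (F : Operator) : Set where
  constructor _by_
  field
    program : Prim
    correct : ∀ O x → eval O program x ≡ F O x
open PR

private variable
  F G H : Operator

pr-cong : PR F → (∀ O x → F O x ≡ G O x) → PR G
pr-cong (p by c) e = p by λ O x → trans (c O x) (e O x)

pr-comp : PR F → PR G → PR (λ O x → F O (G O x))
pr-comp {F = F} (p by c) (q by d) = compᵖ p q by λ O x → trans (c O _) (cong (F O) (d O x))

pr-const : ∀ n → PR (λ _ _ → n)
pr-const zero    = zeroᵖ by λ _ _ → refl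
pr-const (suc n) = pr-comp (succᵖ by λ _ _ → refl) (pr-const n)

pr-id : PR (λ _ x → x)
pr-id = pairᵖ leftᵖ rightᵖ by λ _ → pair-π

pr-suc : PR F → PR (λ O x → suc (F O x))
pr-suc = pr-comp (succᵖ by λ _ _ → refl)

pr-π₁ : PR F → PR (λ O x → π₁ (F O x))
pr-π₁ = pr-comp (leftᵖ by λ _ _ → refl)

pr-π₂ : PR F → PR (λ O x → π₂ (F O x))
pr-π₂ = pr-comp (rightᵖ by λ _ _ → refl)

pr-oracle : PR F → PR (λ O x → O (F O x))
pr-oracle = pr-comp {F = λ O → O} (oracleᵖ by λ _ _ → refl)

pr-pair : PR F → PR G → PR (λ O x → ⟨ F O x , G O x ⟩)
pr-pair (p by c) (q by d) = pairᵖ p q by λ O x → cong₂ ⟨_,_⟩ (c O x) (d O x)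

pr-weaken : PR F → PR (λ O z → F O (π₁ z))
pr-weaken f = pr-comp f (pr-π₁ pr-id)

-- The context of the step is `⟨ x , ⟨ k , u ⟩ ⟩`: the loop counter `k` and the previous value `u`
-- are appended to `x`, hence the projections in the second hypothesis.
pr-natrec : ∀ {S : (ℕ → ℕ) → ℕ → ℕ → ℕ → ℕ} →
  PR F → PR (λ O z → S O (π₁ z) (π₁ (π₂ z)) (π₂ (π₂ z))) → PR G →
  PR (λ O x → natrec (F O x) (S O x) (G O x))
pr-natrec {F = F} {G = G} {S = S} (p by c) (q by d) n =
  pr-cong (pr-comp (precᵖ p q by λ _ _ → refl) (pr-pair pr-id n)) eq
  where
  step : ∀ O x k u → eval O q ⟨ x , ⟨ k , u ⟩ ⟩ ≡ S O x k u
  step O x k u = trans (d O _)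
    (trans (cong (λ a → S O (proj₁ a) (π₁ (proj₂ a)) (π₂ (proj₂ a))) (unpair-pair x _))
           (cong (λ a → S O x (proj₁ a) (proj₂ a)) (unpair-pair k u)))
  eq : ∀ O x → eval O (precᵖ p q) ⟨ x , G O x ⟩ ≡ natrec (F O x) (S O x) (G O x)
  eq O x rewrite π₁-pair x (G O x) | π₂-pair x (G O x) =
    natrec-cong (c O x) (step O x) (G O x)

ifz : ℕ → ℕ → ℕ → ℕ
ifz zero    a b = a
ifz (suc _) a b = b

ifz-natrec : ∀ a b n → natrec a (λ _ _ → b) n ≡ ifz n a b
ifz-natrec a b zero    = refl
ifz-natrec a b (suc n) = refl

pr-ifz : PR F → PR G → PR H → PR (λ O x → ifz (F O x) (G O x) (H O x))
pr-ifz {F = F} {G = G} {H = H} t a b =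
  pr-cong (pr-natrec {S = λ O x _ _ → H O x} a (pr-weaken b) t) λ O x → ifz-natrec (G O x) (H O x) (F O x)

pred-natrec : ∀ n → natrec 0 (λ k _ → k) n ≡ pred n
pred-natrec zero    = refl
pred-natrec (suc n) = refl

pr-pred : PR F → PR (λ O x → pred (F O x))
pr-pred {F = F} f = pr-cong
  (pr-natrec {S = λ _ _ k _ → k} (pr-const 0) (pr-π₁ (pr-π₂ pr-id)) f)
  (λ O x → pred-natrec (F O x))

∸-natrec : ∀ m n → natrec m (λ _ → pred) n ≡ m ∸ n
∸-natrec m zero    = refl
∸-natrec m (suc n) = trans (cong pred (∸-natrec m n)) (pred[m∸n]≡m∸[1+n] m n)

pr-∸ : PR F → PR G → PR (λ O x → F O x ∸ G O x)
pr-∸ {F = F} {G = G} f g = pr-cong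
  (pr-natrec {S = λ _ _ _ → pred} f (pr-pred (pr-π₂ (pr-π₂ pr-id))) g)
  (λ O x → ∸-natrec (F O x) (G O x))

ifeq : ℕ → ℕ → ℕ → ℕ → ℕ
ifeq x y a b = ifz (x ∸ y) (ifz (y ∸ x) a b) b

ifeq-refl : ∀ x {a b} → ifeq x x a b ≡ a
ifeq-refl x rewrite n∸n≡0 x = refl

ifeq-≢ : ∀ {x y a b} → x ≢ y → ifeq x y a b ≡ b
ifeq-≢ {x} {y} x≢y with x ∸ y in p | y ∸ x in q
... | suc _ | _     = refl
... | zero  | suc _ = refl
... | zero  | zero  = contradiction (≤-antisym (m∸n≡0⇒m≤n p) (m∸n≡0⇒m≤n q)) x≢y

private variable
  A B : Operator

pr-ifeq : PR F → PR G → PR A → PR B → PR (λ O x → ifeq (F O x) (G O x) (A O x) (B O x))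
pr-ifeq f g a b = pr-ifz (pr-∸ f g) (pr-ifz (pr-∸ g f) a b) b

-- Course-of-values recursion

drop : ℕ → ℕ → ℕ
drop i h = natrec h (λ _ → π₂) i

drop-pair : ∀ i v h → drop (suc i) ⟨ v , h ⟩ ≡ drop i h
drop-pair zero    v h = π₂-pair v h
drop-pair (suc i) v h = cong π₂ (drop-pair i v h)

-- The table h lists the values at n − 1, …, 0; junk for j ≥ n.

get : ℕ → ℕ → ℕ → ℕ
get n h j = π₁ (drop (n ∸ suc j) h)

pr-get : PR F → PR G → PR H → PR (λ O x → get (F O x) (G O x) (H O x))
pr-get f g h = pr-π₁ (pr-natrec {S = λ _ _ _ → π₂} g
  (pr-π₂ (pr-π₂ (pr-π₂ pr-id))) (pr-∸ f (pr-suc h)))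

Body : Set
Body = (ℕ → ℕ) → (ℕ → ℕ) → ℕ → ℕ

module CourseOfValues (body : Body) where

  table : (ℕ → ℕ) → ℕ → ℕ
  table O = natrec 0 (λ n h → ⟨ body O (get n h) n , h ⟩)

  cov : (ℕ → ℕ) → ℕ → ℕ
  cov O n = body O (get n (table O n)) n

  get-table : ∀ O {j n} → j < n → get n (table O n) j ≡ cov O j
  get-table O {j} {suc n} (s≤s j≤n) with m≤n⇒m<n∨m≡n j≤n
  ... | inj₂ refl rewrite n∸n≡0 n = π₁-pair _ _
  ... | inj₁ j<n =
    trans (cong (λ i → π₁ (drop i (table O (suc n)))) (∸-suc j<n))
          (trans (cong π₁ (drop-pair (n ∸ suc j) _ _)) (get-table O j<n))
    where
    ∸-suc : ∀ {m n} → m < n → n ∸ m ≡ suc (n ∸ suc m)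
    ∸-suc {zero}  {suc n} _       = refl
    ∸-suc {suc m} {suc n} (s≤s p) = ∸-suc p

  module _ (pr-body : PR (λ O z → body O (get (π₁ z) (π₂ z)) (π₁ z))) where

    pr-table : PR F → PR (λ O x → table O (F O x))
    pr-table f = pr-natrec {S = λ O _ n h → ⟨ body O (get n h) n , h ⟩} (pr-const 0)
      (pr-pair (pr-cong (pr-comp pr-body (pr-π₂ pr-id)) λ _ _ → refl) (pr-π₂ (pr-π₂ pr-id))) f

    pr-cov : PR F → PR (λ O x → cov O (F O x))
    pr-cov {F = F} f = pr-cong (pr-comp pr-body (pr-pair f (pr-table f))) λ O x →
      cong (λ (n , h) → body O (get n h) n) (unpair-pair (F O x) (table O (F O x)))

-- Evaluation of programs with a time bound

-- State of the search for a zero among the values r k, where r k is 0 if undefined and suc v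
-- for the value v: 0 = only positive values so far, 1 = undefined value met, suc (suc k) = zero at k.

search : (ℕ → ℕ) → ℕ → ℕ
search r = natrec 0 (λ k u → ifz u (ifz (r k) 1 (ifz (pred (r k)) (suc (suc k)) 0)) u)

-- 0 stands for "no result within the bound s", suc v for the result v.

run : Code → ℕ → ℕ → ℕ
run zeroᶜ       s x = 1
run succᶜ       s x = suc (suc x)
run leftᶜ       s x = suc (π₁ x)
run rightᶜ      s x = suc (π₂ x)
run (pairᶜ f g) s x =
  ifz (run f s x) 0 (ifz (run g s x) 0 (suc ⟨ pred (run f s x) , pred (run g s x) ⟩))
run (compᶜ f g) s x = ifz (run g s x) 0 (run f s (pred (run g s x)))
run (precᶜ f g) s x =
  natrec (run f s (π₁ x)) (λ n u → ifz u 0 (run g s ⟨ π₁ x , ⟨ n , pred u ⟩ ⟩)) (π₂ x)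
-- The bound `s` limits both the time of each test and the length of the search. `pred` merges the
-- states 0 and 1 into "no result".
run (μᶜ f)      s x = pred (search (λ k → run f s ⟨ x , k ⟩) s)

pr-run : ∀ c → PR F → PR G → PR (λ O z → run c (F O z) (G O z))
pr-run zeroᶜ       s x = pr-const 1
pr-run succᶜ       s x = pr-suc (pr-suc x)
pr-run leftᶜ       s x = pr-suc (pr-π₁ x)
pr-run rightᶜ      s x = pr-suc (pr-π₂ x)
pr-run (pairᶜ f g) s x = pr-ifz (pr-run f s x) (pr-const 0)
  (pr-ifz (pr-run g s x) (pr-const 0)
    (pr-suc (pr-pair (pr-pred (pr-run f s x)) (pr-pred (pr-run g s x)))))
pr-run (compᶜ f g) s x =
  pr-ifz (pr-run g s x) (pr-const 0) (pr-run f s (pr-pred (pr-run g s x)))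
pr-run {F} {G} (precᶜ f g) s x = pr-natrec
  {S = λ O z n u → ifz u 0 (run g (F O z) ⟨ π₁ (G O z) , ⟨ n , pred u ⟩ ⟩)}
  (pr-run f s (pr-π₁ x))
  (pr-ifz u (pr-const 0)
    (pr-run g (pr-weaken s) (pr-pair (pr-weaken (pr-π₁ x)) (pr-pair n (pr-pred u)))))
  (pr-π₂ x)
  where
  n = pr-π₁ (pr-π₂ pr-id)
  u = pr-π₂ (pr-π₂ pr-id)
pr-run {F} {G} (μᶜ f) s x = pr-pred (pr-natrec
  {S = λ O z k u → let r = run f (F O z) ⟨ G O z , k ⟩ in
    ifz u (ifz r 1 (ifz (pred r) (suc (suc k)) 0)) u}
  (pr-const 0)
  (pr-ifz u (pr-ifz r (pr-const 1) (pr-ifz (pr-pred r) (pr-suc (pr-suc k)) (pr-const 0))) u)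
  s)
  where
  k = pr-π₁ (pr-π₂ pr-id)
  u = pr-π₂ (pr-π₂ pr-id)
  r = pr-run f (pr-weaken s) (pr-pair (pr-weaken x) k)

ifz-suc : ∀ {r y v} → ifz r 0 y ≡ suc v → (∃[ u ] r ≡ suc u) × y ≡ suc v
ifz-suc {suc r} eq = (r , refl) , eq

Passes : (ℕ → ℕ) → ℕ → Set
Passes r k = ∃[ m ] r k ≡ suc (suc m)

search-zero : ∀ r n → search r n ≡ 0 → ∀ {k} → k < n → Passes r k
search-zero r (suc n) eq {k} (s≤s k≤n) with search r n in p
... | zero with r n in q
...   | suc (suc m) with m≤n⇒m<n∨m≡n k≤n
...     | inj₁ k<n  = search-zero r n p k<n
...     | inj₂ refl = m , q

search-found : ∀ r n {v} → search r n ≡ suc (suc v) →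
  v < n × r v ≡ 1 × (∀ {k} → k < v → Passes r k)
search-found r (suc n) eq with search r n in p
... | suc u with refl ← eq = let (a , b) = search-found r n p in m≤n⇒m≤1+n a , b
... | zero with r n in q | eq
...   | suc zero | refl = ≤-refl , q , search-zero r n p

search-passes : ∀ r n → (∀ {k} → k < n → Passes r k) → search r n ≡ 0
search-passes r zero    h = refl
search-passes r (suc n) h
  rewrite search-passes r n (h ∘ m<n⇒m<1+n) | proj₂ (h (n<1+n n)) = refl

search-complete : ∀ r n {v} → v < n → r v ≡ 1 → (∀ {k} → k < v → Passes r k) →
  search r n ≡ suc (suc v)
search-complete r (suc n) (s≤s v≤n) e h with m≤n⇒m<n∨m≡n v≤n
... | inj₁ v<n rewrite search-complete r n v<n e h = refl
... | inj₂ refl rewrite search-passes r n h | e = refl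

pred-suc : ∀ {n v} → pred n ≡ suc v → n ≡ suc (suc v)
pred-suc {suc n} refl = refl

-- Isolates the loop of `precᶜ` with an arbitrary counter, as needed both for `run-mono` and in the
-- induction of `run-complete`.
natrec-ifz-mono : ∀ {b b′ : ℕ} {r r′ : ℕ → ℕ → ℕ} → (∀ {v} → b ≡ suc v → b′ ≡ suc v) →
  (∀ n {u v} → r n u ≡ suc v → r′ n u ≡ suc v) → ∀ n {v} →
  natrec b (λ n u → ifz u 0 (r n (pred u))) n ≡ suc v →
  natrec b′ (λ n u → ifz u 0 (r′ n (pred u))) n ≡ suc v
natrec-ifz-mono hb hr zero    eq = hb eq
natrec-ifz-mono {b} {r = r} hb hr (suc n) eq
  with ifz-suc {natrec b (λ n u → ifz u 0 (r n (pred u))) n} eq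
... | (u , p) , eq′ rewrite p | natrec-ifz-mono hb hr n p = hr n eq′

-- Lets the bounds of several subcomputations be replaced by their maximum, and ensures that an
-- enumeration obtained from `run` never retracts a pair.
run-mono : ∀ c {s t x v} → s ≤ t → run c s x ≡ suc v → run c t x ≡ suc v
run-mono zeroᶜ  s≤t eq = eq
run-mono succᶜ  s≤t eq = eq
run-mono leftᶜ  s≤t eq = eq
run-mono rightᶜ s≤t eq = eq
run-mono (pairᶜ f g) {s} {t} {x} s≤t eq with ifz-suc {run f s x} eq
... | (u , p) , eq′ with ifz-suc {run g s x} eq′
...   | (w , q) , eq″ rewrite p | q | run-mono f s≤t p | run-mono g s≤t q = eq″
run-mono (compᶜ f g) {s} {t} {x} s≤t eq with ifz-suc {run g s x} eq
... | (u , p) , eq′ rewrite p | run-mono g s≤t p = run-mono f s≤t eq′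
run-mono (precᶜ f g) {s} {t} {x} s≤t = natrec-ifz-mono
  {r = λ n u → run g s ⟨ π₁ x , ⟨ n , u ⟩ ⟩} {r′ = λ n u → run g t ⟨ π₁ x , ⟨ n , u ⟩ ⟩}
  (run-mono f s≤t) (λ _ → run-mono g s≤t) (π₂ x)
run-mono (μᶜ f) {s} {t} {x} {v} s≤t eq =
  let (v<s , e , h) = search-found (λ k → run f s ⟨ x , k ⟩) s (pred-suc eq) in
  cong pred (search-complete (λ k → run f t ⟨ x , k ⟩) t (≤-trans v<s s≤t) (run-mono f s≤t e)
    λ k<v → let (m , p) = h k<v in m , run-mono f s≤t p)

run-sound : ∀ c {s x v} → run c s x ≡ suc v → ⟦ c ⟧ x v
run-sound zeroᶜ  refl = refl
run-sound succᶜ  refl = refl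
run-sound leftᶜ  refl = refl
run-sound rightᶜ refl = refl
run-sound (pairᶜ f g) {s} {x} eq with ifz-suc {run f s x} eq
... | (u , p) , eq′ with ifz-suc {run g s x} eq′
...   | (w , q) , eq″ rewrite p | q =
  u , w , run-sound f p , run-sound g q , sym (suc-injective eq″)
run-sound (compᶜ f g) {s} {x} eq with ifz-suc {run g s x} eq
... | (u , p) , eq′ rewrite p = u , run-sound g p , run-sound f eq′
run-sound (precᶜ f g) {s} {x} = loop (π₂ x)
  where
  a = π₁ x
  step : ℕ → ℕ → ℕ
  step n u = ifz u 0 (run g s ⟨ a , ⟨ n , pred u ⟩ ⟩)
  loop : ∀ n {v} → natrec (run f s a) step n ≡ suc v → rec ⟦ f ⟧ ⟦ g ⟧ a n v
  loop zero    eq = run-sound f eq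
  loop (suc n) eq with ifz-suc {natrec (run f s a) step n} eq
  ... | (u , p) , eq′ rewrite p = u , loop n p , run-sound g eq′
run-sound (μᶜ f) {s} {x} eq =
  let (_ , e , h) = search-found (λ k → run f s ⟨ x , k ⟩) s (pred-suc eq) in
  run-sound f e , λ k k<v → let (m , p) = h k<v in m , run-sound f p

run-complete : ∀ c {x v} → ⟦ c ⟧ x v → ∃[ s ] run c s x ≡ suc v
run-complete zeroᶜ  refl = 0 , refl
run-complete succᶜ  refl = 0 , refl
run-complete leftᶜ  refl = 0 , refl
run-complete rightᶜ refl = 0 , refl
run-complete (pairᶜ f g) {x} {v} (u , w , p , q , refl) with run-complete f p | run-complete g q
... | s , p′ | t , q′ = s ⊔ t , eq
  where
  eq : run (pairᶜ f g) (s ⊔ t) x ≡ suc v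
  eq rewrite run-mono f (m≤m⊔n s t) p′ | run-mono g (m≤n⊔m s t) q′ = refl
run-complete (compᶜ f g) {x} {v} (u , p , q) with run-complete g p | run-complete f q
... | s , p′ | t , q′ = s ⊔ t , eq
  where
  eq : run (compᶜ f g) (s ⊔ t) x ≡ suc v
  eq rewrite run-mono g (m≤m⊔n s t) p′ = run-mono f (m≤n⊔m s t) q′
run-complete (precᶜ f g) {x} = loop (π₂ x)
  where
  a = π₁ x
  approx : ℕ → ℕ → ℕ
  approx s = natrec (run f s a) (λ n u → ifz u 0 (run g s ⟨ a , ⟨ n , pred u ⟩ ⟩))
  approx-mono : ∀ n {s t v} → s ≤ t → approx s n ≡ suc v → approx t n ≡ suc v
  approx-mono n {s} {t} s≤t = natrec-ifz-mono
    {r = λ n u → run g s ⟨ a , ⟨ n , u ⟩ ⟩} {r′ = λ n u → run g t ⟨ a , ⟨ n , u ⟩ ⟩}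
    (run-mono f s≤t) (λ _ → run-mono g s≤t) n
  loop : ∀ n {v} → rec ⟦ f ⟧ ⟦ g ⟧ a n v → ∃[ s ] approx s n ≡ suc v
  loop zero    p = run-complete f p
  loop (suc n) {v} (u , p , q) with loop n p | run-complete g q
  ... | s , p′ | t , q′ = s ⊔ t , eq
    where
    eq : approx (s ⊔ t) (suc n) ≡ suc v
    eq rewrite approx-mono n (m≤m⊔n s t) p′ = run-mono g (m≤n⊔m s t) q′
run-complete (μᶜ f) {x} {v} (p , h) with run-complete f p | bound v (λ k<v → h _ k<v)
  where
  bound : ∀ n → (∀ {k} → k < n → ∃[ m ] ⟦ f ⟧ ⟨ x , k ⟩ (suc m)) →
    ∃[ s ] (∀ {k} → k < n → Passes (λ k → run f s ⟨ x , k ⟩) k)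
  bound zero    h = 0 , λ ()
  bound (suc n) h with h (n<1+n n) | bound n (h ∘ m<n⇒m<1+n)
  ... | m , p | s , hs with run-complete f p
  ...   | t , q = s ⊔ t , passes
    where
    passes : ∀ {k} → k < suc n → Passes (λ k → run f (s ⊔ t) ⟨ x , k ⟩) k
    passes (s≤s k≤n) with m≤n⇒m<n∨m≡n k≤n
    ... | inj₁ k<n  = let (m , e) = hs k<n in m , run-mono f (m≤m⊔n s t) e
    ... | inj₂ refl = m , run-mono f (m≤n⊔m s t) q
... | s , e | t , ht = b , cong pred (search-complete (λ k → run f b ⟨ x , k ⟩) b
    (m≤n⊔m (s ⊔ t) (suc v)) (run-mono f s≤b e)
    λ k<v → let (m , q) = ht k<v in m , run-mono f t≤b q)
  where
  -- The search has to inspect `v` itself, hence `suc v`.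
  b = (s ⊔ t) ⊔ suc v
  s≤b = ≤-trans (m≤m⊔n s t) (m≤m⊔n (s ⊔ t) (suc v))
  t≤b = ≤-trans (m≤n⊔m s t) (m≤m⊔n (s ⊔ t) (suc v))

-- Enumeration of the μ-free programs

-- The numbers 0 to 6 are the tags of all constructors except `μᶜ`; larger `t` also give `precᶜ`. So
-- every number yields a total program.
opcode : ℕ → ℕ → ℕ
opcode t q =
  ifz t (encode zeroᶜ) (ifz (pred t) (encode succᶜ)
  (ifz (pred (pred t)) (encode leftᶜ) (ifz (pred (pred (pred t))) (encode rightᶜ)
  (ifz (pred (pred (pred (pred t)))) ⟨ 4 , q ⟩
  (ifz (pred (pred (pred (pred (pred t))))) ⟨ 5 , q ⟩ ⟨ 6 , q ⟩)))))

programBody : Body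
programBody O G n = opcode (π₁ n) ⟨ G (π₁ (π₂ n)) , G (π₂ (π₂ n)) ⟩

module Programs = CourseOfValues programBody

program# : ℕ → ℕ
program# = Programs.cov (λ _ → 0)

pr-program# : PR F → PR (λ O x → Programs.cov O (F O x))
pr-program# = Programs.pr-cov
  (pr-ifz t (pr-const (encode zeroᶜ)) (pr-ifz (pr-pred t) (pr-const (encode succᶜ))
  (pr-ifz (pr-pred (pr-pred t)) (pr-const (encode leftᶜ))
  (pr-ifz (pr-pred (pr-pred (pr-pred t))) (pr-const (encode rightᶜ))
  (pr-ifz (pr-pred (pr-pred (pr-pred (pr-pred t)))) (pr-pair (pr-const 4) q)
  (pr-ifz (pr-pred (pr-pred (pr-pred (pr-pred (pr-pred t))))) (pr-pair (pr-const 5) q)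
    (pr-pair (pr-const 6) q)))))))
  where
  n = pr-π₁ pr-id
  t = pr-π₁ n
  q = pr-pair (pr-get n (pr-π₂ pr-id) (pr-π₁ (pr-π₂ n)))
              (pr-get n (pr-π₂ pr-id) (pr-π₂ (pr-π₂ n)))

program#-zero : ∀ d → program# ⟨ 0 , d ⟩ ≡ encode zeroᶜ
program#-zero d rewrite π₁-pair 0 d = refl

program#-composite : ∀ t a b →
  program# ⟨ suc t , ⟨ a , b ⟩ ⟩ ≡ opcode (suc t) ⟨ program# a , program# b ⟩
program#-composite t a b
  rewrite π₁-pair (suc t) ⟨ a , b ⟩ | π₂-pair (suc t) ⟨ a , b ⟩ | π₁-pair a b | π₂-pair a b
  = cong₂ (λ u v → opcode (suc t) ⟨ u , v ⟩)
    (Programs.get-table (λ _ → 0) (≤-<-trans (m≤pair a b) (n<pair t ⟨ a , b ⟩)))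
    (Programs.get-table (λ _ → 0) (≤-<-trans (n≤pair a b) (n<pair t ⟨ a , b ⟩)))

-- Programs of the form `plug zeroᶜ p` are those whose totality `plug-computes` provides.
IsProgram# : ℕ → Set
IsProgram# n = ∃[ p ] program# n ≡ encode (plug zeroᶜ p)

program#-sound : ∀ n → IsProgram# n
program#-sound = <-rec IsProgram# λ n rec →
  subst IsProgram# (pair-π n) (cases (π₁ n) (π₂ n) (λ {m} → rec ∘ subst (m <_) (pair-π n)))
  where
  composite : ∀ t a b → IsProgram# a → IsProgram# b → IsProgram# ⟨ suc t , ⟨ a , b ⟩ ⟩
  composite t a b (p , hp) (q , hq) =
    let (r , hr) = assemble t in
    r , trans (program#-composite t a b) (trans (cong₂ (λ u v → opcode (suc t) ⟨ u , v ⟩) hp hq) hr)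
    where
    assemble : ∀ t → ∃[ r ]
      opcode (suc t) ⟨ encode (plug zeroᶜ p) , encode (plug zeroᶜ q) ⟩ ≡ encode (plug zeroᶜ r)
    assemble 0 = succᵖ , refl
    assemble 1 = leftᵖ , refl
    assemble 2 = rightᵖ , refl
    assemble 3 = pairᵖ p q , refl
    assemble 4 = compᵖ p q , refl
    assemble (suc (suc (suc (suc (suc _))))) = precᵖ p q , refl
  cases : ∀ t d → (∀ {m} → m < ⟨ t , d ⟩ → IsProgram# m) → IsProgram# ⟨ t , d ⟩
  cases zero d rec = zeroᵖ , program#-zero d
  cases (suc t) d rec = subst (λ d → IsProgram# ⟨ suc t , d ⟩) (pair-π d)
    (composite t (π₁ d) (π₂ d) (rec (≤-<-trans (π₁-≤ d) (n<pair t d)))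
                               (rec (≤-<-trans (π₂-≤ d) (n<pair t d))))

program#-complete : ∀ p → ∃[ n ] program# n ≡ encode (plug zeroᶜ p)
program#-complete oracleᵖ = ⟨ 0 , 0 ⟩ , program#-zero 0
program#-complete zeroᵖ   = ⟨ 0 , 0 ⟩ , program#-zero 0
program#-complete succᵖ   = ⟨ 1 , ⟨ 0 , 0 ⟩ ⟩ , program#-composite 0 0 0
program#-complete leftᵖ   = ⟨ 2 , ⟨ 0 , 0 ⟩ ⟩ , program#-composite 1 0 0
program#-complete rightᵖ  = ⟨ 3 , ⟨ 0 , 0 ⟩ ⟩ , program#-composite 2 0 0
program#-complete (pairᵖ p q) with program#-complete p | program#-complete q
... | a , ha | b , hb = ⟨ 4 , ⟨ a , b ⟩ ⟩ , trans (program#-composite 3 a b) (cong₂ (λ u v → ⟨ 4 , ⟨ u , v ⟩ ⟩) ha hb)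
program#-complete (compᵖ p q) with program#-complete p | program#-complete q
... | a , ha | b , hb = ⟨ 5 , ⟨ a , b ⟩ ⟩ , trans (program#-composite 4 a b) (cong₂ (λ u v → ⟨ 5 , ⟨ u , v ⟩ ⟩) ha hb)
program#-complete (precᵖ p q) with program#-complete p | program#-complete q
... | a , ha | b , hb = ⟨ 6 , ⟨ a , b ⟩ ⟩ , trans (program#-composite 5 a b) (cong₂ (λ u v → ⟨ 6 , ⟨ u , v ⟩ ⟩) ha hb)

-- `plug` on Gödel numbers, an instance of the s-m-n theorem; 4, 5 and 6 are the tags of `pairᶜ`,
-- `compᶜ` and `precᶜ`.
plug# : Prim → ℕ → ℕ
plug# oracleᵖ     e = e
plug# zeroᵖ       e = encode zeroᶜ
plug# succᵖ       e = encode succᶜ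
plug# leftᵖ       e = encode leftᶜ
plug# rightᵖ      e = encode rightᶜ
plug# (pairᵖ f g) e = ⟨ 4 , ⟨ plug# f e , plug# g e ⟩ ⟩
plug# (compᵖ f g) e = ⟨ 5 , ⟨ plug# f e , plug# g e ⟩ ⟩
plug# (precᵖ f g) e = ⟨ 6 , ⟨ plug# f e , plug# g e ⟩ ⟩

plug#-encode : ∀ p d → plug# p (encode d) ≡ encode (plug d p)
plug#-encode oracleᵖ     d = refl
plug#-encode zeroᵖ       d = refl
plug#-encode succᵖ       d = refl
plug#-encode leftᵖ       d = refl
plug#-encode rightᵖ      d = refl
plug#-encode (pairᵖ f g) d = cong₂ (λ u v → ⟨ 4 , ⟨ u , v ⟩ ⟩) (plug#-encode f d) (plug#-encode g d)
plug#-encode (compᵖ f g) d = cong₂ (λ u v → ⟨ 5 , ⟨ u , v ⟩ ⟩) (plug#-encode f d) (plug#-encode g d)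
plug#-encode (precᵖ f g) d = cong₂ (λ u v → ⟨ 6 , ⟨ u , v ⟩ ⟩) (plug#-encode f d) (plug#-encode g d)

pr-plug# : ∀ p → PR F → PR (λ O x → plug# p (F O x))
pr-plug# oracleᵖ     f = f
pr-plug# zeroᵖ       f = pr-const (encode zeroᶜ)
pr-plug# succᵖ       f = pr-const (encode succᶜ)
pr-plug# leftᵖ       f = pr-const (encode leftᶜ)
pr-plug# rightᵖ      f = pr-const (encode rightᶜ)
pr-plug# (pairᵖ p q) f = pr-pair (pr-const 4) (pr-pair (pr-plug# p f) (pr-plug# q f))
pr-plug# (compᵖ p q) f = pr-pair (pr-const 5) (pr-pair (pr-plug# p f) (pr-plug# q f))
pr-plug# (precᵖ p q) f = pr-pair (pr-const 6) (pr-pair (pr-plug# p f) (pr-plug# q f))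

-- Unbounded search for a solution of an equation

least : ∀ (r : ℕ → ℕ) n → r n ≡ 0 → ∃[ v ] r v ≡ 0 × (∀ k → k < v → ∃[ m ] r k ≡ suc m)
least r n eq with r 0 in p
... | zero  = 0 , p , λ _ ()
least r zero    eq | suc m with () ← trans (sym p) eq
least r (suc n) eq | suc m with least (r ∘ suc) n eq
... | v , q , h = suc v , q , λ { zero _ → m , p ; (suc k) (s≤s k<v) → h k k<v }

solve : Prim → Code → Code
solve p d = μᶜ (plug d p)

dom-solve : ∀ {d O} → Computes d O → ∀ p z → z ∈ Dom (solve p d) ⇔ (∃[ n ] eval O p ⟨ z , n ⟩ ≡ 0)
dom-solve {d} {O} h p z = mk⇔
  (λ (v , e , _) → v , sym (unique hp e))
  (λ (n , e) → let (v , e′ , hv) = least (λ n → eval O p ⟨ z , n ⟩) n e in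
    v , Equivalence.from (graph hp _ _) (sym e′) ,
    λ k k<v → let (m , q) = hv k k<v in m , Equivalence.from (graph hp _ _) (sym q))
  where hp = plug-computes h p

difference : PR F → PR G → PR (λ O z → ifeq (F O z) (G O z) 0 1)
difference f g = pr-ifeq f g (pr-const 0) (pr-const 1)

ifeq-zero : ∀ {x y} → ifeq x y 0 1 ≡ 0 → x ≡ y
ifeq-zero {x} {y} eq with x ≟ y
... | yes x≡y = x≡y
... | no  x≢y with () ← trans (sym (ifeq-≢ x≢y)) eq

dom-equation : ∀ {d O} → Computes d O → (f : PR F) (g : PR G) → ∀ z →
  z ∈ Dom (solve (program (difference f g)) d) ⇔ (∃[ n ] F O ⟨ z , n ⟩ ≡ G O ⟨ z , n ⟩)
dom-equation {F} {G} {d} {O} h f g z = mk⇔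
  (λ p → let (n , e) = Equivalence.to domain p in
    n , ifeq-zero (trans (sym (correct diff O _)) e))
  (λ (n , e) → Equivalence.from domain (n , trans (correct diff O _)
    (trans (cong (λ y → ifeq (F O ⟨ z , n ⟩) y 0 1) (sym e)) (ifeq-refl (F O ⟨ z , n ⟩)))))
  where
  diff = difference f g
  domain = dom-solve h (program diff) z

-- The free interpolable relation

base : ℕ → ℕ
base n = ⟨ 0 , n ⟩

child : ℕ → ℕ → ℕ
child t k = ⟨ suc t , k ⟩

parentEdge : ℕ → ℕ
parentEdge d = ⟨ child (π₁ d) (π₂ d) , π₁ d ⟩

-- O ⟨ q , ⟨ a , b ⟩ ⟩ is nonzero if a ≺ b is seen at time q; here a and b are shifted
-- by one, with 0 for an unresolved element.

related : (ℕ → ℕ) → ℕ → ℕ → ℕ → ℕ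
related O q a b = ifz a 0 (ifz b 0 (O ⟨ q , ⟨ pred a , pred b ⟩ ⟩))

module Rules (O e : ℕ → ℕ) (r : ℕ → ℕ → ℕ) where

  -- The edge with number ⟨ op , d ⟩: parent, transitivity, next child, promise, inherited edge.
  -- The parent edge doubles as a default when the side condition of op fails.

  edgeRule : ℕ → ℕ → ℕ
  edgeRule op d =
    ifz op (parentEdge d)
    (ifz (pred op)
      (ifeq (π₂ (e (π₁ d))) (π₁ (e (π₂ d))) ⟨ π₁ (e (π₁ d)) , π₂ (e (π₂ d)) ⟩ (parentEdge d))
    (ifz (pred (pred op)) ⟨ child (π₁ d) (π₂ d) , child (π₁ d) (suc (π₂ d)) ⟩
    (ifz (pred (pred (pred op))) ⟨ π₁ (e d) , child (π₂ (e d)) (suc d) ⟩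
    (ifz (related O (π₁ d) (r (π₁ d) (π₁ (π₂ d))) (r (π₁ d) (π₂ (π₂ d))))
      (parentEdge d) (π₂ d)))))

  -- The element promised to lie below `child t (suc k)` on account of edge `k`. If edge `k` does
  -- not end at `t`, the default `child t k` makes the check repeat the one on the preceding child.
  source : ℕ → ℕ → ℕ
  source t k = ifeq t (π₂ (e k)) (π₁ (e k)) (child t k)

  -- At stage s, try to resolve ⟨ a , k ⟩ to π₁ s using what is known of ≺ at time π₂ s.
  -- Going through child t k, only the one promise caused by edge k has to be checked.

  attempt : ℕ → ℕ → ℕ → ℕ
  attempt s a k =
    ifz a (suc k)
    (ifz (related O (π₂ s) (suc (π₁ s)) (r s (pred a))) 0
    (ifz k (suc (π₁ s))
    (ifz (related O (π₂ s) (r s (child (pred a) (pred k))) (suc (π₁ s))) 0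
    (ifz (related O (π₂ s) (r s (source (pred a) (pred k))) (suc (π₁ s))) 0
      (suc (π₁ s))))))

  resolveRule : ℕ → ℕ → ℕ
  resolveRule s w = ifz s 0
    (ifz (r (pred s) w) (attempt (pred s) (π₁ w) (π₂ w)) (r (pred s) w))

-- Edges and stages depend on each other: resolution checks promises, and inherited edges need
-- resolved end points. One recursion computes both, entry `n` holding edge `n` and stage `π₁ n` of
-- the element `π₂ n`.
henkinBody : Body
henkinBody O G n = ⟨ edgeRule (π₁ n) (π₂ n) , resolveRule (π₁ n) (π₂ n) ⟩
  where open Rules O (π₁ ∘ G) (λ s w → π₂ (G ⟨ s , w ⟩))

module Henkin = CourseOfValues henkinBody

opaque

  edge : (ℕ → ℕ) → ℕ → ℕ
  edge O n = π₁ (Henkin.cov O n)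

  -- stage O s w is 0 while w is unresolved at stage s, and suc u once w is resolved to u.

  stage : (ℕ → ℕ) → ℕ → ℕ → ℕ
  stage O s w = π₂ (Henkin.cov O ⟨ s , w ⟩)

pr-henkinBody : PR (λ O z → henkinBody O (get (π₁ z) (π₂ z)) (π₁ z))
pr-henkinBody = pr-pair pr-edgeRule pr-resolveRule
  where
  n = pr-π₁ pr-id
  op = pr-π₁ n
  d = pr-π₂ n

  pr-e : PR F → PR (λ O z → π₁ (get (π₁ z) (π₂ z) (F O z)))
  pr-e f = pr-π₁ (pr-get n (pr-π₂ pr-id) f)

  pr-r : PR F → PR G → PR (λ O z → π₂ (get (π₁ z) (π₂ z) ⟨ F O z , G O z ⟩))
  pr-r f g = pr-π₂ (pr-get n (pr-π₂ pr-id) (pr-pair f g))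

  pr-child : PR F → PR G → PR (λ O z → child (F O z) (G O z))
  pr-child f g = pr-pair (pr-suc f) g

  pr-parentEdge : PR F → PR (λ O z → parentEdge (F O z))
  pr-parentEdge f = pr-pair (pr-child (pr-π₁ f) (pr-π₂ f)) (pr-π₁ f)

  pr-related : PR F → PR G → PR H → PR (λ O z → related O (F O z) (G O z) (H O z))
  pr-related q a b = pr-ifz a (pr-const 0) (pr-ifz b (pr-const 0)
    (pr-oracle (pr-pair q (pr-pair (pr-pred a) (pr-pred b)))))

  pr-edgeRule =
    pr-ifz op (pr-parentEdge d)
    (pr-ifz (pr-pred op)
      (pr-ifeq (pr-π₂ (pr-e (pr-π₁ d))) (pr-π₁ (pr-e (pr-π₂ d)))
        (pr-pair (pr-π₁ (pr-e (pr-π₁ d))) (pr-π₂ (pr-e (pr-π₂ d)))) (pr-parentEdge d))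
    (pr-ifz (pr-pred (pr-pred op))
      (pr-pair (pr-child (pr-π₁ d) (pr-π₂ d)) (pr-child (pr-π₁ d) (pr-suc (pr-π₂ d))))
    (pr-ifz (pr-pred (pr-pred (pr-pred op)))
      (pr-pair (pr-π₁ (pr-e d)) (pr-child (pr-π₂ (pr-e d)) (pr-suc d)))
    (pr-ifz (pr-related (pr-π₁ d) (pr-r (pr-π₁ d) (pr-π₁ (pr-π₂ d))) (pr-r (pr-π₁ d) (pr-π₂ (pr-π₂ d))))
      (pr-parentEdge d) (pr-π₂ d)))))

  s = pr-pred op
  a = pr-π₁ d
  k = pr-π₂ d
  u = pr-suc (pr-π₁ s)
  t = pr-pred a
  j = pr-pred k

  pr-resolveRule =
    pr-ifz op (pr-const 0)
    (pr-ifz (pr-r s d)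
      (pr-ifz a (pr-suc k)
      (pr-ifz (pr-related (pr-π₂ s) u (pr-r s t)) (pr-const 0)
      (pr-ifz k u
      (pr-ifz (pr-related (pr-π₂ s) (pr-r s (pr-child t j)) u) (pr-const 0)
      (pr-ifz (pr-related (pr-π₂ s)
        (pr-r s (pr-ifeq t (pr-π₂ (pr-e j)) (pr-π₁ (pr-e j)) (pr-child t j))) u) (pr-const 0)
        u)))))
      (pr-r s d))

opaque
  unfolding edge

  pr-edge : PR F → PR (λ O x → edge O (F O x))
  pr-edge f = pr-π₁ (Henkin.pr-cov pr-henkinBody f)

-- Well-foundedness: the rules consult only smaller numbers

ifeq-either : ∀ x y {a b} → ifeq x y a b ≡ a ⊎ ifeq x y a b ≡ b
ifeq-either x y with x ∸ y | y ∸ x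
... | zero  | zero  = inj₁ refl
... | zero  | suc _ = inj₂ refl
... | suc _ | _     = inj₂ refl

-- `suc (k + k)` is the bound of `edge-source-≤`, so the source of edge `k` is no larger than the
-- element that carries its promise.
child-≤ : ∀ t k {x} → x ≤ suc (k + k) → x ≤ child t (suc k)
child-≤ t k x≤ = ≤-trans x≤ (≤-trans (s≤s bound) (m+2n≤pair (suc t) (suc k)))
  where
  bound : k + k ≤ k + (suc t + suc k)
  bound = +-monoʳ-≤ k (≤-trans (n≤1+n k) (m≤n+m (suc k) (suc t)))

parent<child : ∀ t k → t < child t k
parent<child t k = m≤pair (suc t) k

child-<-suc : ∀ t k → child t k < child t (suc k)
child-<-suc t k = child-suc
  where
  opaque
    unfolding ⟨_,_⟩
    child-suc : child t k < child t (suc k)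
    child-suc = s≤s (+-monoʳ-≤ k (triangle-mono-≤ (+-monoʳ-≤ (suc t) (n≤1+n k))))

-- With `d = ⟨ q , ⟨ x , y ⟩ ⟩` this places stage `q` of `x` and of `y` before an inherited edge
-- with data `d`.
stage-< : ∀ op d {w} → w ≤ π₂ d → ⟨ π₁ d , w ⟩ < ⟨ suc op , d ⟩
stage-< op d {w} w≤ =
  ≤-<-trans (subst (⟨ π₁ d , w ⟩ ≤_) (pair-π d) (pair-mono-≤ ≤-refl w≤)) (n<pair op d)

-- Rules that agree on smaller numbers agree, so the table of the recursion may be replaced by
-- `edge` and `stage` themselves; this gives `edge-at` and `stage-at`.
module Locality (O : ℕ → ℕ) {e e′ : ℕ → ℕ} {r r′ : ℕ → ℕ → ℕ} where
  private
    module R  = Rules O e r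
    module R′ = Rules O e′ r′

  edgeRule-local : ∀ op d → (∀ {j} → j < ⟨ op , d ⟩ → e j ≡ e′ j) →
    (∀ {s w} → ⟨ s , w ⟩ < ⟨ op , d ⟩ → r s w ≡ r′ s w) →
    R.edgeRule op d ≡ R′.edgeRule op d
  edgeRule-local 0 d he hr = refl
  edgeRule-local 1 d he hr
    rewrite he (≤-<-trans (π₁-≤ d) (n<pair 0 d)) | he (≤-<-trans (π₂-≤ d) (n<pair 0 d)) = refl
  edgeRule-local 2 d he hr = refl
  edgeRule-local 3 d he hr rewrite he (n<pair 2 d) = refl
  edgeRule-local (suc (suc (suc (suc op)))) d he hr
    rewrite hr (stage-< (3 + op) d (π₁-≤ (π₂ d))) | hr (stage-< (3 + op) d (π₂-≤ (π₂ d))) = refl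

  source-≤ : ∀ t k → π₁ (e′ k) ≤ suc (k + k) → R′.source t k ≤ child t (suc k)
  source-≤ t k bound with ifeq-either t (π₂ (e′ k)) {π₁ (e′ k)} {child t k}
  ... | inj₁ eq rewrite eq = child-≤ t k bound
  ... | inj₂ eq rewrite eq = <⇒≤ (child-<-suc t k)

  attempt-local : ∀ s a k → (∀ j → π₁ (e′ j) ≤ suc (j + j)) →
    (∀ {j} → j < ⟨ a , k ⟩ → e j ≡ e′ j) → (∀ {x} → x ≤ ⟨ a , k ⟩ → r s x ≡ r′ s x) →
    R.attempt s a k ≡ R′.attempt s a k
  attempt-local s zero    k       bound he hr = refl
  attempt-local s (suc t) zero    bound he hr rewrite hr (<⇒≤ (parent<child t 0)) = refl
  attempt-local s (suc t) (suc k) bound he hr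
    rewrite hr (<⇒≤ (parent<child t (suc k))) | hr (<⇒≤ (child-<-suc t k))
          | he (n≤pair (suc t) (suc k)) | hr (source-≤ t k (bound k)) = refl

  resolveRule-local : ∀ s w → (∀ j → π₁ (e′ j) ≤ suc (j + j)) →
    (∀ {j} → j < ⟨ s , w ⟩ → e j ≡ e′ j) →
    (∀ {s′ w′} → ⟨ s′ , w′ ⟩ < ⟨ s , w ⟩ → r s′ w′ ≡ r′ s′ w′) →
    R.resolveRule s w ≡ R′.resolveRule s w
  resolveRule-local zero    w bound he hr = refl
  resolveRule-local (suc s) w bound he hr
    rewrite hr (pair-<ˡ s w)
          | attempt-local s (π₁ w) (π₂ w) bound
              (λ {j} j< → he (<-trans (subst (j <_) (pair-π w) j<) (n<pair s w)))
              (λ {x} x≤ → hr (≤-<-trans (pair-mono-≤ ≤-refl (subst (x ≤_) (pair-π w) x≤)) (pair-<ˡ s w)))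
    = refl

-- Recursion equations, interpolability and resolution

module HenkinRelation (O : ℕ → ℕ) where

  open Rules O (edge O) (stage O)

  private
    lookup : ℕ → ℕ → ℕ
    lookup n = get n (Henkin.table O n)

    module L n = Rules O (π₁ ∘ lookup n) (λ s w → π₂ (lookup n ⟨ s , w ⟩))

  opaque
    unfolding edge

    edge-at : ∀ op d → edge O ⟨ op , d ⟩ ≡ edgeRule op d
    edge-at op d = trans (π₁-pair _ _) (trans
      (cong (λ p → L.edgeRule ⟨ op , d ⟩ (proj₁ p) (proj₂ p)) (unpair-pair op d))
      (Locality.edgeRule-local O op d
        (cong π₁ ∘ Henkin.get-table O) (cong π₂ ∘ Henkin.get-table O)))

  -- Makes the recursion for `stage` legitimate: an attempt at `child t (suc k)` looks at the source
  -- of edge `k`. For `d = ⟨ t , k ⟩` the source `child t k` is `suc (t + k) + d`, at most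
  -- `suc (d + d)`; transitivity and promises copy the source of an earlier edge, and an inherited
  -- edge contains its source in its number.
  edge-source-≤ : ∀ n → π₁ (edge O n) ≤ suc (n + n)
  edge-source-≤ = <-rec _ λ n rec →
    subst (λ n → π₁ (edge O n) ≤ suc (n + n)) (pair-π n)
      (cases (π₁ n) (π₂ n) λ {m} m< → rec (subst (m <_) (pair-π n) m<))
    where
    double : ∀ {m n} → m ≤ n → suc (m + m) ≤ suc (n + n)
    double p = s≤s (+-mono-≤ p p)

    child-bound : ∀ d → child (π₁ d) (π₂ d) ≤ suc (d + d)
    child-bound d rewrite pair-suc (π₁ d) (π₂ d) | pair-π d =
      s≤s (+-monoˡ-≤ d (subst (π₁ d + π₂ d ≤_) (pair-π d) (m+n≤pair (π₁ d) (π₂ d))))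

    parentEdge-bound : ∀ op d → π₁ (parentEdge d) ≤ suc (⟨ op , d ⟩ + ⟨ op , d ⟩)
    parentEdge-bound op d rewrite π₁-pair (child (π₁ d) (π₂ d)) (π₁ d) =
      ≤-trans (child-bound d) (double (n≤pair op d))

    cases : ∀ op d → (∀ {m} → m < ⟨ op , d ⟩ → π₁ (edge O m) ≤ suc (m + m)) →
      π₁ (edge O ⟨ op , d ⟩) ≤ suc (⟨ op , d ⟩ + ⟨ op , d ⟩)
    cases op d rec rewrite edge-at op d = go op rec
      where
      go : ∀ op → (∀ {m} → m < ⟨ op , d ⟩ → π₁ (edge O m) ≤ suc (m + m)) →
        π₁ (edgeRule op d) ≤ suc (⟨ op , d ⟩ + ⟨ op , d ⟩)
      go 0 rec = parentEdge-bound 0 d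
      go 1 rec with ifeq-either (π₂ (edge O (π₁ d))) (π₁ (edge O (π₂ d)))
                      {⟨ π₁ (edge O (π₁ d)) , π₂ (edge O (π₂ d)) ⟩} {parentEdge d}
      ... | inj₂ eq rewrite eq = parentEdge-bound 1 d
      ... | inj₁ eq rewrite eq | π₁-pair (π₁ (edge O (π₁ d))) (π₂ (edge O (π₂ d))) =
        ≤-trans (rec (≤-<-trans (π₁-≤ d) (n<pair 0 d)))
                (double (≤-trans (π₁-≤ d) (n≤pair 1 d)))
      go 2 rec rewrite π₁-pair (child (π₁ d) (π₂ d)) (child (π₁ d) (suc (π₂ d))) =
        ≤-trans (child-bound d) (double (n≤pair 2 d))
      go 3 rec rewrite π₁-pair (π₁ (edge O d)) (child (π₂ (edge O d)) (suc d)) =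
        ≤-trans (rec (n<pair 2 d)) (double (n≤pair 3 d))
      go (suc (suc (suc (suc op)))) rec
        with related O (π₁ d) (stage O (π₁ d) (π₁ (π₂ d))) (stage O (π₁ d) (π₂ (π₂ d)))
      ... | zero  = parentEdge-bound (4 + op) d
      ... | suc _ = ≤-trans (≤-trans (π₁-≤ (π₂ d)) (≤-trans (π₂-≤ d) (n≤pair (4 + op) d)))
                            (≤-trans (m≤m+n _ _) (n≤1+n _))

  opaque
    unfolding edge

    stage-at : ∀ s w → stage O s w ≡ resolveRule s w
    stage-at s w = trans (π₂-pair _ _) (trans
      (cong (λ p → L.resolveRule ⟨ s , w ⟩ (proj₁ p) (proj₂ p)) (unpair-pair s w))
      (Locality.resolveRule-local O s w edge-source-≤
        (cong π₁ ∘ Henkin.get-table O) (cong π₂ ∘ Henkin.get-table O)))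

  infix 4 _⋖_
  _⋖_ : Rel ℕ 0ℓ
  x ⋖ y = ∃[ n ] edge O n ≡ ⟨ x , y ⟩

  child-⋖ : ∀ t k → child t k ⋖ t
  child-⋖ t k = ⟨ 0 , ⟨ t , k ⟩ ⟩ , trans (edge-at 0 _)
    (cong (λ (t , k) → ⟨ child t k , t ⟩) (unpair-pair t k))

  child-⋖-suc : ∀ t k → child t k ⋖ child t (suc k)
  child-⋖-suc t k = ⟨ 2 , ⟨ t , k ⟩ ⟩ , trans (edge-at 2 _)
    (cong (λ (t , k) → ⟨ child t k , child t (suc k) ⟩) (unpair-pair t k))

  ⋖-child : ∀ {x t} k → edge O k ≡ ⟨ x , t ⟩ → x ⋖ child t (suc k)
  ⋖-child {x} {t} k eq = ⟨ 3 , k ⟩ , trans (edge-at 3 k)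
    (cong (λ (x , t) → ⟨ x , child t (suc k) ⟩) (trans (cong unpair eq) (unpair-pair x t)))

  ⋖-trans : ∀ {x y z} → x ⋖ y → y ⋖ z → x ⋖ z
  ⋖-trans {x} {y} {z} (i , p) (j , q) = ⟨ 1 , ⟨ i , j ⟩ ⟩ , trans (edge-at 1 _) eq
    where
    eq : edgeRule 1 ⟨ i , j ⟩ ≡ ⟨ x , z ⟩
    eq rewrite π₁-pair i j | π₂-pair i j | p | q
             | π₁-pair x y | π₂-pair x y | π₁-pair y z | π₂-pair y z = ifeq-refl y

  child-⋖-< : ∀ t {j k} → j < k → child t j ⋖ child t k
  child-⋖-< t {j} {suc k} (s≤s j≤k) with m≤n⇒m<n∨m≡n j≤k
  ... | inj₁ j<k  = ⋖-trans (child-⋖-< t j<k) (child-⋖-suc t k)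
  ... | inj₂ refl = child-⋖-suc t k

  ⋖-interpolable : Interpolable _⋖_
  ⋖-interpolable = ⋖-trans , λ y → (child y 0 , child-⋖ y 0) , λ (i , p) (j , q) →
    -- Edges `i` and `j` are promised to the children `suc i` and `suc j`; `k` exceeds both indices,
    -- so `child y k` lies strictly above these children.
    let k = 2 + (i ⊔ j) in
    child y k , child-⋖ y k ,
    ⋖-trans (⋖-child i p) (child-⋖-< y (s≤s (s≤s (m≤m⊔n i j)))) ,
    ⋖-trans (⋖-child j q) (child-⋖-< y (s≤s (s≤s (m≤n⊔m i j))))

  -- Resolving elements bounded by N needs only edges below N, and these have bounded end points:
  -- the measure for the simultaneous induction on edges and elements.

  data Bounded (N : ℕ) : ℕ → Set where
    baseᵇ  : ∀ n → Bounded N (base n)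
    childᵇ : ∀ {t k} → Bounded N t → k ≤ N → Bounded N (child t k)

  bounded-≤ : ∀ w {N} → w ≤ N → Bounded N w
  bounded-≤ = <-rec (λ w → ∀ {N} → w ≤ N → Bounded N w) λ w rec {N} w≤ →
    subst (Bounded N) (pair-π w) (cases (π₁ w) (π₂ w) (subst (_≤ N) (sym (pair-π w)) w≤)
      λ {m} m< → rec (subst (m <_) (pair-π w) m<))
    where
    cases : ∀ {N} a k → ⟨ a , k ⟩ ≤ N → (∀ {m} → m < ⟨ a , k ⟩ → m ≤ N → Bounded N m) →
      Bounded N ⟨ a , k ⟩
    cases zero    k w≤ rec = baseᵇ k
    cases (suc t) k w≤ rec = childᵇ
      (rec (parent<child t k) (≤-trans (<⇒≤ (parent<child t k)) w≤))
      (≤-trans (n≤pair (suc t) k) w≤)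

  bounded-mono : ∀ {M N w} → M ≤ N → Bounded M w → Bounded N w
  bounded-mono M≤N (baseᵇ n)    = baseᵇ n
  bounded-mono M≤N (childᵇ b p) = childᵇ (bounded-mono M≤N b) (≤-trans p M≤N)

  EdgeBounded : ℕ → ℕ → Set
  EdgeBounded N z = Bounded N (π₁ z) × Bounded N (π₂ z)

  edgeBounded-pair : ∀ {N x y} → Bounded N x → Bounded N y → EdgeBounded N ⟨ x , y ⟩
  edgeBounded-pair {N} {x} {y} p q =
    subst (Bounded N) (sym (π₁-pair x y)) p , subst (Bounded N) (sym (π₂-pair x y)) q

  edge-bounded : ∀ n → EdgeBounded n (edge O n)
  edge-bounded = <-rec _ λ n rec → subst (λ n → EdgeBounded n (edge O n)) (pair-π n)
    (subst (EdgeBounded _) (sym (edge-at (π₁ n) (π₂ n)))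
      (go (π₁ n) (π₂ n) λ {m} m< → rec (subst (m <_) (pair-π n) m<)))
    where
    parent : ∀ op d → EdgeBounded ⟨ op , d ⟩ (parentEdge d)
    parent op d = edgeBounded-pair (childᵇ b (≤-trans (π₂-≤ d) (n≤pair op d))) b
      where b = bounded-≤ _ (≤-trans (π₁-≤ d) (n≤pair op d))
    go : ∀ op d → (∀ {m} → m < ⟨ op , d ⟩ → EdgeBounded m (edge O m)) →
      EdgeBounded ⟨ op , d ⟩ (edgeRule op d)
    go 0 d rec = parent 0 d
    go 1 d rec with ifeq-either (π₂ (edge O (π₁ d))) (π₁ (edge O (π₂ d)))
                      {⟨ π₁ (edge O (π₁ d)) , π₂ (edge O (π₂ d)) ⟩} {parentEdge d}
    ... | inj₂ eq rewrite eq = parent 1 d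
    ... | inj₁ eq rewrite eq = edgeBounded-pair
      (bounded-mono (<⇒≤ i<) (proj₁ (rec i<))) (bounded-mono (<⇒≤ j<) (proj₂ (rec j<)))
      where
      i< = ≤-<-trans (π₁-≤ d) (n<pair 0 d)
      j< = ≤-<-trans (π₂-≤ d) (n<pair 0 d)
    go 2 d rec = edgeBounded-pair
      (childᵇ b (≤-trans (π₂-≤ d) (n≤pair 2 d))) (childᵇ b (≤-trans (s≤s (π₂-≤ d)) (n<pair 1 d)))
      where b = bounded-≤ _ (≤-trans (π₁-≤ d) (n≤pair 2 d))
    go 3 d rec = edgeBounded-pair
      -- Read as `suc d ≤ ⟨ 3 , d ⟩`, `d<` also bounds the index of the promised child.
      (bounded-mono (<⇒≤ d<) (proj₁ (rec d<))) (childᵇ (bounded-mono (<⇒≤ d<) (proj₂ (rec d<))) d<)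
      where d< = n<pair 2 d
    go (suc (suc (suc (suc op)))) d rec
      with related O (π₁ d) (stage O (π₁ d) (π₁ (π₂ d))) (stage O (π₁ d) (π₂ (π₂ d)))
    ... | zero  = parent (4 + op) d
    ... | suc _ = bounded-≤ _ (≤-trans (π₁-≤ (π₂ d)) π₂d≤) , bounded-≤ _ (≤-trans (π₂-≤ (π₂ d)) π₂d≤)
      where π₂d≤ = ≤-trans (π₂-≤ d) (n≤pair (4 + op) d)

  -- w is eventually resolved to u.

  infix 4 _↦_
  _↦_ : Rel ℕ 0ℓ
  w ↦ u = ∃[ s ] stage O s w ≡ suc u

  stage-mono : ∀ {s t w u} → s ≤ t → stage O s w ≡ suc u → stage O t w ≡ suc u
  stage-mono {t = zero}  z≤n eq = eq
  stage-mono {s} {suc t} {w} s≤ eq with m≤n⇒m<n∨m≡n s≤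
  ... | inj₂ refl = eq
  ... | inj₁ (s≤s s≤t) rewrite stage-at (suc t) w | stage-mono s≤t eq = refl

  ↦-unique : ∀ {w u v} → w ↦ u → w ↦ v → u ≡ v
  ↦-unique (s , p) (t , q) = suc-injective
    (trans (sym (stage-mono (m≤m⊔n s t) p)) (stage-mono (m≤n⊔m s t) q))

  -- Descending from stage `s`, the value first appears right after the attempt that produced it.
  attempted-by : ∀ s {w u} → stage O s w ≡ suc u → ∃[ s ] attempt s (π₁ w) (π₂ w) ≡ suc u
  attempted-by zero    {w} eq with () ← trans (sym (stage-at 0 w)) eq
  attempted-by (suc s) {w} eq with stage O s w in p | trans (sym (stage-at (suc s) w)) eq
  ... | zero  | eq′ = s , eq′
  ... | suc v | eq′ = attempted-by s (trans p eq′)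

  attempted : ∀ {w u} → w ↦ u → ∃[ s ] attempt s (π₁ w) (π₂ w) ≡ suc u
  attempted (s , eq) = attempted-by s eq

  -- `v` may differ from `u`, because an earlier resolution takes precedence over a later successful
  -- attempt.
  attempt-resolves : ∀ {s a k u} → attempt s a k ≡ suc u → ∃[ v ] ⟨ a , k ⟩ ↦ v
  attempt-resolves {s} {a} {k} {u} eq = let (v , p) = go in v , suc s , trans (stage-at (suc s) _) p
    where
    go : ∃[ v ] resolveRule (suc s) ⟨ a , k ⟩ ≡ suc v
    go with stage O s ⟨ a , k ⟩
    ... | suc v = v , refl
    ... | zero  rewrite π₁-pair a k | π₂-pair a k = u , eq

  related-suc : ∀ q a b {m} → related O q a b ≡ suc m →
    ∃[ a′ ] ∃[ b′ ] a ≡ suc a′ × b ≡ suc b′ × O ⟨ q , ⟨ a′ , b′ ⟩ ⟩ ≡ suc m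
  related-suc q (suc a) (suc b) eq = a , b , refl , refl , eq

-- Resolution when `O` enumerates `≺`

module _ {O : ℕ → ℕ} {_≺_ : Rel ℕ 0ℓ}
  (O-sound : ∀ {s a b m} → O ⟨ s , ⟨ a , b ⟩ ⟩ ≡ suc m → a ≺ b)
  (O-complete : ∀ {a b} → a ≺ b → ∃[ r ] (∀ {s} → r ≤ s → ∃[ m ] O ⟨ s , ⟨ a , b ⟩ ⟩ ≡ suc m))
  where

  open HenkinRelation O
  open Rules O (edge O) (stage O)

  base-↦⁻¹ : ∀ {n u} → base n ↦ u → u ≡ n
  base-↦⁻¹ {n} p with attempted p
  ... | s , eq rewrite π₁-pair 0 n | π₂-pair 0 n = sym (suc-injective eq)

  base-↦ : ∀ n → base n ↦ n
  base-↦ n with attempt-resolves {0} {0} {n} refl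
  ... | u , p with refl ← base-↦⁻¹ p = p

  child-attempted : ∀ {t k u} → child t k ↦ u → ∃[ s ] attempt s (suc t) k ≡ suc u
  child-attempted {t} {k} p with attempted p
  ... | s , eq rewrite π₁-pair (suc t) k | π₂-pair (suc t) k = s , eq

  parent-related : ∀ s t {u m} → related O (π₂ s) (suc (π₁ s)) (stage O s t) ≡ suc m →
    π₁ s ≡ u → ∃[ v ] t ↦ v × u ≺ v
  parent-related s t e refl with related-suc (π₂ s) (suc (π₁ s)) (stage O s t) e
  ... | _ , v , refl , q , o = v , (s , q) , O-sound o

  child-related : ∀ s w {u m} → related O (π₂ s) (stage O s w) (suc (π₁ s)) ≡ suc m →
    π₁ s ≡ u → ∃[ v ] w ↦ v × v ≺ u
  child-related s w e refl with related-suc (π₂ s) (stage O s w) (suc (π₁ s)) e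
  ... | v , _ , q , refl , o = v , (s , q) , O-sound o

  -- The first check of the successful attempt compares the candidate with the value of the parent.
  child-↦⁻¹ : ∀ {t k u} → child t k ↦ u → ∃[ v ] t ↦ v × u ≺ v
  child-↦⁻¹ {t} {zero} p with child-attempted p
  ... | s , eq with ifz-suc {related O (π₂ s) (suc (π₁ s)) (stage O s t)} eq
  ... | (_ , e) , eq₁ = parent-related s t e (suc-injective eq₁)
  child-↦⁻¹ {t} {suc k} p with child-attempted p
  ... | s , eq with ifz-suc {related O (π₂ s) (suc (π₁ s)) (stage O s t)} eq
  ... | (_ , e) , eq₁ with ifz-suc {related O (π₂ s) (stage O s (child t k)) (suc (π₁ s))} eq₁
  ... | _ , eq₂ with ifz-suc {related O (π₂ s) (stage O s (source t k)) (suc (π₁ s))} eq₂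
  ... | _ , eq₃ = parent-related s t e (suc-injective eq₃)

  child-suc-↦⁻¹ : ∀ {t k u} → child t (suc k) ↦ u →
    (∃[ v ] child t k ↦ v × v ≺ u) × (∃[ v ] source t k ↦ v × v ≺ u)
  child-suc-↦⁻¹ {t} {k} p with child-attempted p
  ... | s , eq with ifz-suc {related O (π₂ s) (suc (π₁ s)) (stage O s t)} eq
  ... | _ , eq₁ with ifz-suc {related O (π₂ s) (stage O s (child t k)) (suc (π₁ s))} eq₁
  ... | (_ , e₂) , eq₂ with ifz-suc {related O (π₂ s) (stage O s (source t k)) (suc (π₁ s))} eq₂
  ... | (_ , e₃) , eq₃ = child-related s (child t k) e₂ (suc-injective eq₃) ,
                         child-related s (source t k) e₃ (suc-injective eq₃)

  Resolves : ℕ → Set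
  Resolves w = ∃[ u ] w ↦ u

  related-at : ∀ {q a b a′ b′} → a ≡ suc a′ → b ≡ suc b′ →
    (∃[ m ] O ⟨ q , ⟨ a′ , b′ ⟩ ⟩ ≡ suc m) → ∃[ m ] related O q a b ≡ suc m
  related-at refl refl p = p

  attempt-zero : ∀ s t → (∃[ m ] related O (π₂ s) (suc (π₁ s)) (stage O s t) ≡ suc m) →
    attempt s (suc t) 0 ≡ suc (π₁ s)
  attempt-zero s t (_ , p) rewrite p = refl

  attempt-suc : ∀ s t k → (∃[ m ] related O (π₂ s) (suc (π₁ s)) (stage O s t) ≡ suc m) →
    (∃[ m ] related O (π₂ s) (stage O s (child t k)) (suc (π₁ s)) ≡ suc m) →
    (∃[ m ] related O (π₂ s) (stage O s (source t k)) (suc (π₁ s)) ≡ suc m) →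
    attempt s (suc t) (suc k) ≡ suc (π₁ s)
  attempt-suc s t k (_ , p) (_ , q) (_ , r) rewrite p | q | r = refl

  resolves-child-zero : ∀ {t v u} → t ↦ v → u ≺ v → Resolves (child t 0)
  resolves-child-zero {t} {v} {u} (s , p) u≺v with O-complete u≺v
  ... | r , o = attempt-resolves (attempt-zero c t
      (related-at (cong suc (π₁-pair u b)) (stage-mono s≤c p) (o r≤q)))
    where
    b = s ⊔ r
    -- Stage `c` proposes `u` and consults `O` at time `b`. Since `b ≤ c`, the parent is resolved by
    -- then, and `b` is late enough for `u ≺ v` to be seen.
    c = ⟨ u , b ⟩
    s≤c : s ≤ c
    s≤c = ≤-trans (m≤m⊔n s r) (n≤pair u b)
    r≤q : r ≤ π₂ c
    r≤q rewrite π₂-pair u b = m≤n⊔m s r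

  resolves-child-suc : ∀ {t k v v′ v″ u} → t ↦ v → child t k ↦ v′ → source t k ↦ v″ →
    u ≺ v → v′ ≺ u → v″ ≺ u → Resolves (child t (suc k))
  resolves-child-suc {t} {k} {u = u} (s , p) (s′ , p′) (s″ , p″) u≺v v′≺u v″≺u
    with O-complete u≺v | O-complete v′≺u | O-complete v″≺u
  ... | r , o | r′ , o′ | r″ , o″ = attempt-resolves (attempt-suc c t k
      (related-at e (stage-mono (stages (m≤m+n s _)) p) (o (times (m≤m+n r _))))
      (related-at (stage-mono (stages (m≤n⇒m≤o+n s (m≤m+n s′ s″))) p′) e
        (o′ (times (m≤n⇒m≤o+n r (m≤m+n r′ r″)))))
      (related-at (stage-mono (stages (m≤n⇒m≤o+n s (m≤n+m s″ s′))) p″) e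
        (o″ (times (m≤n⇒m≤o+n r (m≤n+m r″ r′))))))
    where
    ss = s + (s′ + s″)
    rs = r + (r′ + r″)
    b = ss ⊔ rs
    c = ⟨ u , b ⟩
    e : suc (π₁ c) ≡ suc u
    e = cong suc (π₁-pair u b)
    stages : ∀ {x} → x ≤ ss → x ≤ c
    stages h = ≤-trans h (≤-trans (m≤m⊔n ss rs) (n≤pair u b))
    times : ∀ {x} → x ≤ rs → x ≤ π₂ c
    times h rewrite π₂-pair u b = ≤-trans h (m≤n⊔m ss rs)

  module _ (≺-interpolable : Interpolable _≺_) where

    Sound : ℕ → Set
    Sound z = ∀ {a b} → π₁ z ↦ a → π₂ z ↦ b → a ≺ b

    sound-pair : ∀ {x y} → (∀ {a b} → x ↦ a → y ↦ b → a ≺ b) → Sound ⟨ x , y ⟩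
    sound-pair {x} {y} h p q =
      h (subst (_↦ _) (π₁-pair x y) p) (subst (_↦ _) (π₂-pair x y) q)

    -- Parent, next-child and promised edges hold by the checks made when the child was resolved,
    -- and an inherited edge was seen in `≺`. Resolvability below `n` enters through transitivity,
    -- where the middle element must have a value.
    edge-sound : ∀ n → (∀ {w} → Bounded n w → Resolves w) → Sound (edge O n)
    edge-sound = <-rec (λ n → (∀ {w} → Bounded n w → Resolves w) → Sound (edge O n))
      λ n rec → subst Step (pair-π n) (step (π₁ n) (π₂ n)) rec
      where
      Step : ℕ → Set
      Step n = (∀ {m} → m < n → (∀ {w} → Bounded m w → Resolves w) → Sound (edge O m)) →
        (∀ {w} → Bounded n w → Resolves w) → Sound (edge O n)
      parent : ∀ d → Sound (parentEdge d)
      parent d = sound-pair λ p q → let (v , p′ , u≺v) = child-↦⁻¹ p in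
        subst (_ ≺_) (↦-unique p′ q) u≺v
      step : ∀ op d → Step ⟨ op , d ⟩
      step op d rec total rewrite edge-at op d = go op rec total
        where
        go : ∀ op → (∀ {m} → m < ⟨ op , d ⟩ → (∀ {w} → Bounded m w → Resolves w) → Sound (edge O m)) →
          (∀ {w} → Bounded ⟨ op , d ⟩ w → Resolves w) → Sound (edgeRule op d)
        go 0 rec total = parent d
        go 1 rec total with π₂ (edge O (π₁ d)) ≟ π₁ (edge O (π₂ d))
        ... | no  i≢j rewrite ifeq-≢ {a = ⟨ π₁ (edge O (π₁ d)) , π₂ (edge O (π₂ d)) ⟩} {parentEdge d} i≢j =
          parent d
        ... | yes i≡j rewrite sym i≡j
          | ifeq-refl (π₂ (edge O (π₁ d))) {⟨ π₁ (edge O (π₁ d)) , π₂ (edge O (π₂ d)) ⟩} {parentEdge d} =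
          sound-pair λ p q →
            let (v , m) = total (bounded-mono (<⇒≤ i<) (proj₂ (edge-bounded (π₁ d)))) in
            proj₁ ≺-interpolable
              (rec i< (total ∘ bounded-mono (<⇒≤ i<)) p m)
              (rec j< (total ∘ bounded-mono (<⇒≤ j<)) (subst (_↦ v) i≡j m) q)
          where
          i< = ≤-<-trans (π₁-≤ d) (n<pair 0 d)
          j< = ≤-<-trans (π₂-≤ d) (n<pair 0 d)
        go 2 rec total = sound-pair λ p q → let ((v , p′ , v≺u) , _) = child-suc-↦⁻¹ q in
          subst (_≺ _) (↦-unique p′ p) v≺u
        go 3 rec total = sound-pair λ p q → let (_ , (v , p′ , v≺u)) = child-suc-↦⁻¹ q in
          -- Edge `d` ends at the parent of the promised child, so `source` takes its first branch.
          subst (_≺ _) (↦-unique (subst (_↦ v) (ifeq-refl (π₂ (edge O d))) p′) p) v≺u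
        go (suc (suc (suc (suc op)))) rec total p q
          with related O (π₁ d) (stage O (π₁ d) (π₁ (π₂ d))) (stage O (π₁ d) (π₂ (π₂ d))) in eq
        ... | zero  = parent d p q
        ... | suc _ = let (a , b , p′ , q′ , o) = related-suc (π₁ d) (stage O (π₁ d) (π₁ (π₂ d))) (stage O (π₁ d) (π₂ (π₂ d))) eq in
          subst₂ _≺_ (↦-unique (_ , p′) p) (↦-unique (_ , q′) q) (O-sound o)

    -- The values of `child t k` and of the promised source both lie below `v`, the latter because
    -- edge `k` is sound. Directedness of the segment below `v` then supplies a candidate `u` that
    -- passes all checks.
    next-child : ∀ {t v k} → t ↦ v → Resolves (child t k) → (∀ {w} → Bounded k w → Resolves w) →
      Resolves (child t (suc k))
    next-child {t} {v} {k} p (v′ , p′) rec =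
      let (v″ , p″ , v″≺v) = source-below
          (u , u≺v , v′≺u , v″≺u) = proj₂ (proj₂ ≺-interpolable v) v′≺v v″≺v
      in resolves-child-suc p p′ p″ u≺v v′≺u v″≺u
      where
      v′≺v : v′ ≺ v
      v′≺v = let (_ , q , h) = child-↦⁻¹ p′ in subst (v′ ≺_) (↦-unique q p) h
      source-below : ∃[ v″ ] source t k ↦ v″ × v″ ≺ v
      source-below with t ≟ π₂ (edge O k)
      ... | no  t≢ = v′ , subst (_↦ v′) (sym (ifeq-≢ t≢)) p′ , v′≺v
      ... | yes refl =
        let (v″ , p″) = rec (proj₁ (edge-bounded k)) in
        v″ , subst (_↦ v″) (sym (ifeq-refl t)) p″ , edge-sound k rec p″ p

    -- Induction on the bound, then on the formation of the element, then on the child index: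
    -- `child t (suc k)` depends on edge `k`, and `suc k ≤ N` makes `rec` available at `k`.
    resolves-step : ∀ {N} → (∀ {M} → M < N → ∀ {w} → Bounded M w → Resolves w) →
      ∀ {w} → Bounded N w → Resolves w
    resolves-step rec (baseᵇ n) = n , base-↦ n
    resolves-step {N} rec (childᵇ {t} {k} b k≤N) = children (resolves-step rec b) k k≤N
      where
      children : Resolves t → ∀ k → k ≤ N → Resolves (child t k)
      children (v , p) zero    k≤N =
        let (u , u≺v) = proj₁ (proj₂ ≺-interpolable v) in resolves-child-zero p u≺v
      children (v , p) (suc k) k<N = next-child p (children (v , p) k (<⇒≤ k<N)) (rec k<N)

    bounded-resolves : ∀ N {w} → Bounded N w → Resolves w
    bounded-resolves = <-rec (λ N → ∀ {w} → Bounded N w → Resolves w) λ _ rec → resolves-step rec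

    resolves : ∀ w → Resolves w
    resolves w = bounded-resolves w (bounded-≤ w ≤-refl)

    value-of : ℕ → ℕ
    value-of w = proj₁ (resolves w)

    value-of-base : ∀ n → value-of (base n) ≡ n
    value-of-base n = base-↦⁻¹ (proj₂ (resolves (base n)))

    ⋖-sound : ∀ {x y} → x ⋖ y → value-of x ≺ value-of y
    ⋖-sound {x} {y} (n , eq) = edge-sound n (λ _ → resolves _)
      (subst (_↦ _) (sym (trans (cong π₁ eq) (π₁-pair x y))) (proj₂ (resolves x)))
      (subst (_↦ _) (sym (trans (cong π₂ eq) (π₂-pair x y))) (proj₂ (resolves y)))

    ⋖-complete : ∀ {x y} → value-of x ≺ value-of y → x ⋖ y
    ⋖-complete {x} {y} h with resolves x | resolves y
    ... | a , s , p | b , t , q with O-complete h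
    -- An inherited edge at a time `c` when both elements are resolved and `O` has listed the pair
    -- of their values.
    ...   | r , o = ⟨ 4 , ⟨ c , ⟨ x , y ⟩ ⟩ ⟩ , trans (edge-at 4 _) eq
      where
      c = (s ⊔ t) ⊔ r
      eq : edgeRule 4 ⟨ c , ⟨ x , y ⟩ ⟩ ≡ ⟨ x , y ⟩
      eq rewrite π₁-pair c ⟨ x , y ⟩ | π₂-pair c ⟨ x , y ⟩ | π₁-pair x y | π₂-pair x y
        | stage-mono (≤-trans (m≤m⊔n s t) (m≤m⊔n (s ⊔ t) r)) p
        | stage-mono (≤-trans (m≤n⊔m s t) (m≤m⊔n (s ⊔ t) r)) q
        | proj₂ (o (m≤n⊔m (s ⊔ t) r)) = refl

-- Ideal spaces of equivalent presentations

-- A finite list of conditions on `f I` is secured by choosing one condition on `I` for each of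
-- them.
effective⇒continuous : ∀ {_≺_ _⊏_ : Rel ℕ 0ℓ} {f : Ideal _≺_ → Ideal _⊏_} →
  Effective f → Continuous f
effective⇒continuous {_≺_} {_⊏_} {f} (A , _ , preimage) U U-open I fI∈U =
  let (ns , fI∈ , inside) = U-open (f I) fI∈U
      (ms , I∈ , sufficient) = gather fI∈
  in ms , I∈ , λ J J∈ → inside (f J) (sufficient J J∈)
  where
  gather : ∀ {ns} → All (λ n → f I ∈ [ n ]) ns →
    ∃[ ms ] All (λ m → I ∈ [ m ]) ms ×
      (∀ (J : Ideal _≺_) → All (λ m → J ∈ [ m ]) ms → All (λ n → f J ∈ [ n ]) ns)
  gather [] = [] , [] , λ _ _ → []
  gather {n ∷ _} (p ∷ ps) =
    let (m , a , I∈m) = Equivalence.to (preimage n I) p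
        (ms , I∈ , h) = gather ps
    in m ∷ ms , I∈m ∷ I∈ , λ { J (q ∷ qs) → Equivalence.from (preimage n J) (m , a , q) ∷ h J qs }

-- `⊏` sees elements only through `ρ`, so ideals cannot separate `w` from `σ (ρ w)`; this makes the
-- pullback along a map with a section a homeomorphism of ideal spaces.
module Pullback {_⊏_ _≺_ : Rel ℕ 0ℓ} (ρ σ : ℕ → ℕ)
  (reflects : ∀ {x y} → ρ x ≺ ρ y → x ⊏ y) (preserves : ∀ {x y} → x ⊏ y → ρ x ≺ ρ y)
  (ρ∘σ : ∀ n → ρ (σ n) ≡ n)
  where

  σρ-⊏ : ∀ {x y} → x ⊏ y → σ (ρ x) ⊏ y
  σρ-⊏ {x} {y} p = reflects (subst (_≺ ρ y) (sym (ρ∘σ (ρ x))) (preserves p))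

  σρ-⊏⁻¹ : ∀ {x y} → σ (ρ x) ⊏ y → x ⊏ y
  σρ-⊏⁻¹ {x} {y} p = reflects (subst (_≺ ρ y) (ρ∘σ (ρ x)) (preserves p))

  σ-⊏ : ∀ {n y} → n ≺ ρ y → σ n ⊏ y
  σ-⊏ {n} {y} p = reflects (subst (_≺ ρ y) (sym (ρ∘σ n)) p)

  member-σρ : ∀ (J : Ideal _⊏_) {w} → w ∈ member J → σ (ρ w) ∈ member J
  -- Directedness applied to `w` twice yields a member `z` with `w ⊏ z`, even if `⊏` is irreflexive.
  member-σρ J w∈ = let (z , z∈ , w⊏z , _) = proj₂ (Ideal.directed J) w∈ w∈ in
    Ideal.lower J (σρ-⊏ w⊏z) z∈

  member-σρ⁻¹ : ∀ (J : Ideal _⊏_) {w} → σ (ρ w) ∈ member J → w ∈ member J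
  member-σρ⁻¹ J w∈ = let (z , z∈ , w⊏z , _) = proj₂ (Ideal.directed J) w∈ w∈ in
    Ideal.lower J (σρ-⊏⁻¹ w⊏z) z∈

  forth : Ideal _⊏_ → Ideal _≺_
  forth J = record
    { member   = λ n → σ n ∈ member J
    ; lower    = λ {x} {y} x≺y → Ideal.lower J (σ-⊏ (subst (x ≺_) (sym (ρ∘σ y)) x≺y))
    ; directed =
      (let (w , w∈) = proj₁ (Ideal.directed J) in ρ w , member-σρ J w∈) ,
      λ {x} {y} x∈ y∈ → let (z , z∈ , x⊏z , y⊏z) = proj₂ (Ideal.directed J) x∈ y∈ in
        ρ z , member-σρ J z∈ ,
        subst (_≺ ρ z) (ρ∘σ x) (preserves x⊏z) , subst (_≺ ρ z) (ρ∘σ y) (preserves y⊏z)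
    }

  back : Ideal _≺_ → Ideal _⊏_
  back I = record
    { member   = λ w → ρ w ∈ member I
    ; lower    = λ x⊏y → Ideal.lower I (preserves x⊏y)
    ; directed =
      (let (n , n∈) = proj₁ (Ideal.directed I) in σ n , subst (member I) (sym (ρ∘σ n)) n∈) ,
      λ {x} {y} x∈ y∈ → let (z , z∈ , x≺z , y≺z) = proj₂ (Ideal.directed I) x∈ y∈ in
        σ z , subst (member I) (sym (ρ∘σ z)) z∈ ,
        reflects (subst (ρ x ≺_) (sym (ρ∘σ z)) x≺z) , reflects (subst (ρ y ≺_) (sym (ρ∘σ z)) y≺z)
    }

  forth-effective : CE (λ n w → w ≡ σ n) → Effective forth
  forth-effective ce = _ , ce , λ n J →
    mk⇔ (λ p → σ n , refl , p) (λ { (_ , refl , p) → p })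

  -- Expresses `ρ w ∈ I` without computing `ρ`: ideals are rounded, so the condition holds exactly
  -- if `w ⊏ σ n` for some `n ∈ I`.
  back-effective : CE (λ w n → w ⊏ σ n) → Effective back
  back-effective ce = _ , ce , λ w I → mk⇔
    (λ p → let (z , z∈ , w≺z , _) = proj₂ (Ideal.directed I) p p in
      z , reflects (subst (ρ w ≺_) (sym (ρ∘σ z)) w≺z) , z∈)
    (λ (n , w⊏ , n∈) → Ideal.lower I (subst (ρ w ≺_) (ρ∘σ n) (preserves w⊏)) n∈)

  bijection : Inverse (𝓘 _⊏_) (𝓘 _≺_)
  bijection = record
    { to        = forth
    ; from      = back
    ; to-cong   = λ (p , q) → (λ {n} → p {σ n}) , (λ {n} → q {σ n})
    ; from-cong = λ (p , q) → (λ {w} → p {ρ w}) , (λ {w} → q {ρ w})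
    ; inverse   =
      (λ {I} (p , q) → (λ {n} n∈ → subst (member I) (ρ∘σ n) (p n∈)) ,
                       (λ {n} n∈ → q (subst (member I) (sym (ρ∘σ n)) n∈))) ,
      (λ {J} (p , q) → (λ {w} w∈ → member-σρ⁻¹ J (p w∈)) ,
                       (λ {w} w∈ → q (member-σρ J w∈)))
    }

  homeomorphism : CE (λ n w → w ≡ σ n) → CE (λ w n → w ⊏ σ n) → ComputableHomeomorphism _⊏_ _≺_
  homeomorphism ce₁ ce₂ = record
    { bijection       = bijection
    ; to-continuous   = effective⇒continuous (forth-effective ce₁)
    ; from-continuous = effective⇒continuous (back-effective ce₂)
    ; to-effective    = forth-effective ce₁
    ; from-effective  = back-effective ce₂
    }

-- Assembly of the computable enumeration

interpolable-⇔ : ∀ {_≺_ _⊏_ : Rel ℕ 0ℓ} → (∀ {x y} → x ≺ y ⇔ x ⊏ y) →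
  Interpolable _⊏_ → Interpolable _≺_
interpolable-⇔ iff (tr , dir) =
  (λ p q → from (tr (to p) (to q))) ,
  λ y → (let (x , p) = proj₁ (dir y) in x , from p) ,
    λ p q → let (z , r , s , t) = proj₂ (dir y) (to p) (to q) in z , from r , from s , from t
  where
  to   = λ {x} {y} → Equivalence.to (iff {x} {y})
  from = λ {x} {y} → Equivalence.from (iff {x} {y})

pr-edge-of : PR (λ O z → edge O (π₂ z))
pr-edge-of = pr-edge (pr-π₂ pr-id)

edgeSearch : Prim
edgeSearch = program (difference pr-edge-of (pr-π₁ pr-id))

-- The program for ⋖, given a program for O.

henkin : Code → Code
henkin = solve edgeSearch

W-encode : ∀ c {x} → x ∈ W (encode c) ⇔ x ∈ Dom c
W-encode c = mk⇔
  (λ (c′ , eq , p) → subst (λ c → _ ∈ Dom c) (encode-injective c′ c eq) p)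
  (λ p → c , refl , p)

module _ {d O} (h : Computes d O) where

  open HenkinRelation O

  edge-equation : ∀ z {w} →
    (∃[ n ] edge O (π₂ ⟨ z , n ⟩) ≡ w) ⇔ (∃[ n ] edge O n ≡ w)
  edge-equation z {w} = mk⇔
    (λ (n , eq) → _ , eq)
    (λ (n , eq) → n , trans (cong (edge O) (π₂-pair z n)) eq)

  W₂-henkin : ∀ {x y} → W₂ (encode (henkin d)) x y ⇔ x ⋖ y
  W₂-henkin {x} {y} = mk⇔
    (λ p → let (n , eq) = Equivalence.to domain (Equivalence.to (W-encode (henkin d)) p) in
      Equivalence.to (edge-equation z) (n , trans eq (π₁-pair z n)))
    (λ p → let (n , eq) = Equivalence.from (edge-equation z) p in
      Equivalence.from (W-encode (henkin d)) (Equivalence.from domain (n , trans eq (sym (π₁-pair z n)))))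
    where
    z = ⟨ x , y ⟩
    domain = dom-equation h pr-edge-of (pr-π₁ pr-id) z

  ⋖-base-CE : CE (λ w n → w ⋖ base n)
  ⋖-base-CE = solve (program (difference pr-edge-of pr-target)) d , λ w n → let z = ⟨ w , n ⟩ ; domain = dom-equation h pr-edge-of pr-target z in mk⇔
    (λ p → let (m , eq) = Equivalence.from (edge-equation z) p in
      Equivalence.from domain (m , trans eq (sym (target w n m))))
    (λ p → let (m , eq) = Equivalence.to domain p in
      Equivalence.to (edge-equation z) (m , trans eq (target w n m)))
    where
    pr-target : PR (λ O z → ⟨ π₁ (π₁ z) , base (π₂ (π₁ z)) ⟩)
    pr-target = pr-pair (pr-π₁ (pr-π₁ pr-id)) (pr-pair (pr-const 0) (pr-π₂ (pr-π₁ pr-id)))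
    target : ∀ w n m → ⟨ π₁ (π₁ ⟨ ⟨ w , n ⟩ , m ⟩) , base (π₂ (π₁ ⟨ ⟨ w , n ⟩ , m ⟩)) ⟩ ≡ ⟨ w , base n ⟩
    target w n m rewrite π₁-pair ⟨ w , n ⟩ m | π₁-pair w n | π₂-pair w n = refl

base-CE : CE (λ n w → w ≡ base n)
base-CE = solve (program (difference pr-w pr-base)) zeroᶜ , λ n w → let domain = dom-equation zeroᶜ-computes pr-w pr-base ⟨ n , w ⟩ in mk⇔
  -- The equation is independent of the search variable, so 0 serves as a solution.
  (λ p → Equivalence.from domain (0 , Equivalence.from (graph≡ n w 0) p))
  (λ p → let (m , eq) = Equivalence.to domain p in Equivalence.to (graph≡ n w m) eq)
  where
  pr-w : PR (λ O z → π₂ (π₁ z))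
  pr-w = pr-π₂ (pr-π₁ pr-id)
  pr-base : PR (λ O z → base (π₁ (π₁ z)))
  pr-base = pr-pair (pr-const 0) (pr-π₁ (pr-π₁ pr-id))
  graph≡ : ∀ n w m → (π₂ (π₁ ⟨ ⟨ n , w ⟩ , m ⟩) ≡ base (π₁ (π₁ ⟨ ⟨ n , w ⟩ , m ⟩))) ⇔ (w ≡ base n)
  graph≡ n w m rewrite π₁-pair ⟨ n , w ⟩ m | π₁-pair n w | π₂-pair n w = mk⇔ id id

CE-⇔ : ∀ {_≺_ _⊏_ : Rel ℕ 0ℓ} → (∀ {x y} → x ≺ y ⇔ x ⊏ y) → CE _⊏_ → CE _≺_
CE-⇔ iff (c , ce) = c , λ x y → mk⇔
  (Equivalence.to (ce x y) ∘ Equivalence.to iff) (Equivalence.from iff ∘ Equivalence.from (ce x y))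

-- 7 is the tag of `μᶜ`, the outermost constructor of `henkin d`.
index : ℕ → ℕ
index i = ⟨ 7 , plug# edgeSearch (program# i) ⟩

index-henkin : ∀ i {d} → program# i ≡ encode d → index i ≡ encode (henkin d)
index-henkin i {d} eq = cong ⟨ 7 ,_⟩ (trans (cong (plug# edgeSearch) eq) (plug#-encode edgeSearch d))

index-computable : Computable index
index-computable = plug zeroᶜ (program pr-index) , λ x →
  subst (⟦ plug zeroᶜ (program pr-index) ⟧ x) (correct pr-index (λ _ → 0) x)
    (value (plug-computes zeroᶜ-computes (program pr-index)) x)
  where
  pr-index : PR (λ O x → ⟨ 7 , plug# edgeSearch (Programs.cov O x) ⟩)
  pr-index = pr-pair (pr-const 7) (pr-plug# edgeSearch (pr-program# pr-id))

-- Holds for every total `O`, whatever it enumerates; hence each index yields an admissible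
-- relation.
henkin-interpolable : ∀ {d O} → Computes d O → Interpolable (W₂ (encode (henkin d)))
henkin-interpolable {O = O} h = interpolable-⇔ (W₂-henkin h) (HenkinRelation.⋖-interpolable O)

-- Bounded evaluation of a fixed `c` is primitive recursive in time and argument, so it occurs among
-- the enumerated programs even if `c` contains `μᶜ`.
pr-clock : ∀ c → PR (λ O z → run c (π₁ z) (π₂ z))
pr-clock c = pr-run c (pr-π₁ pr-id) (pr-π₂ pr-id)

henkin-homeomorphism : ∀ {_≺_ : Rel ℕ 0ℓ} (ce : CE _≺_) → Interpolable _≺_ →
  ComputableHomeomorphism (W₂ (encode (henkin (plug zeroᶜ (program (pr-clock (proj₁ ce))))))) _≺_
henkin-homeomorphism {_≺_} (c , ce) ≺-interpolable = Pullback.homeomorphism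
  (value-of sound complete ≺-interpolable) base
  (Equivalence.from (W₂-henkin h) ∘ ⋖-complete sound complete ≺-interpolable)
  (⋖-sound sound complete ≺-interpolable ∘ Equivalence.to (W₂-henkin h))
  (value-of-base sound complete ≺-interpolable)
  base-CE (CE-⇔ (W₂-henkin h) (⋖-base-CE h))
  where
  O : ℕ → ℕ
  O = eval (λ _ → 0) (program (pr-clock c))

  h : Computes (plug zeroᶜ (program (pr-clock c))) O
  h = plug-computes zeroᶜ-computes (program (pr-clock c))

  clock : ∀ s z → O ⟨ s , z ⟩ ≡ run c s z
  clock s z = trans (correct (pr-clock c) _ _) (cong₂ (run c) (π₁-pair s z) (π₂-pair s z))

  sound : ∀ {s a b m} → O ⟨ s , ⟨ a , b ⟩ ⟩ ≡ suc m → a ≺ b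
  sound {s} {a} {b} eq = Equivalence.from (ce a b)
    (_ , run-sound c (trans (sym (clock s ⟨ a , b ⟩)) eq))

  complete : ∀ {a b} → a ≺ b → ∃[ r ] (∀ {s} → r ≤ s → ∃[ m ] O ⟨ s , ⟨ a , b ⟩ ⟩ ≡ suc m)
  complete {a} {b} p =
    let (m , q) = Equivalence.to (ce a b) p
        (r , eq) = run-complete c q
    in r , λ {s} r≤s → m , trans (clock s ⟨ a , b ⟩) (run-mono c r≤s eq)

theorem21 : ∃[ f ] Computable f
    × (∀ i → Interpolable (W₂ (f i)))
    × (∀ (_≺_ : Rel ℕ 0ℓ) → CE _≺_ → Interpolable _≺_ →
    ∃[ i ] ComputableHomeomorphism (W₂ (f i)) _≺_)
theorem21 = index , index-computable ,
  (λ i → let (p , eq) = program#-sound i in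
    subst (Interpolable ∘ W₂) (sym (index-henkin i eq))
      (henkin-interpolable (plug-computes zeroᶜ-computes p))) ,
  λ _≺_ ce ≺-interpolable → let (i , eq) = program#-complete (program (pr-clock (proj₁ ce))) in
    i , subst (λ e → ComputableHomeomorphism (W₂ e) _≺_) (sym (index-henkin i eq))
          (henkin-homeomorphism ce ≺-interpolable)
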